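{- There is an absolute constant $c>0$ such that for every positive integer $n$ there is an $n$-element noncorectilinear point set $P\subset[-1,n]^2$ (contained in the interior of the rectangle $R=[-1,n]^2$) for which the diameter of the graph of rectangulations $G(P)$ within $R$ is at least $c\,n\log n$. (That is, the diameter of $G(P)$ is $\Omega(n\log n)$.)
   Context: A finite point set in the plane is noncorectilinear if its points have pairwise distinct $x$-coordinates and pairwise distinct $y$-coordinates. Let $P$ be a noncorectilinear set of $n$ points in the interior of an axis-aligned rectangle $R$. A rectangulation of $P$ (within $R$) is a subdivision of $R$ into rectangles by exactly $n$ pairwise noncrossing axis-parallel (horizontal or vertical) line segments, each containing exactly one point of $P$, this point lying in the relative interior of the segment. (So each endpoint of a segment lies on the boundary of $R$ or in the relative interior of an orthogonal segment.) Flip$(r,p)$: let $r$ be a rectangulation of $P$ and $p\in P$ such that the segment $s$ containing $p$ does not contain any endpoints of other segments. The operation changes the orientation of $s$ from vertical to horizontal or vice versa (replacing $s$ by the orthogonal segment through $p$ that extends in both directions until it reaches another segment or the boundary of $R$). Rotate$(r,c)$: let $s_1=ab$ be a segment of $r$ containing $p\in P$, and let $s_2=cd$ be a segment of $r$ such that its endpoint $c$ lies in $ap\subset s_1$ and $ac$ does not contain any endpoints of other segments. The operation shortens $s_1$ to $cb$ and extends $s_2$ beyond $c$ until it reaches another segment or the boundary of $R$. The graph of rectangulations $G(P)$ has as vertices all rectangulations of $P$, and $r_1,r_2$ are adjacent iff a single flip or rotate operation on $r_1$ produces $r_2$. Both operations are reversible, so $G(P)$ is undirected. The diameter is the maximum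 graph distance between two vertices. -}

module Defs where

open import Data.Fin using (Fin)
open import Data.Integer using (+_; -1ℤ)
open import Data.Nat using (ℕ; zero; suc)
open import Data.Product using (Σ; ∃; ∃-syntax; _×_)
open import Data.Rational using (ℚ; _/_; _≤_; _<_)
open import Data.Sum using (_⊎_)
open import Function using (_∘_)
open import Function.Definitions using (Injective)
open import Relation.Binary.PropositionalEquality using (_≡_; _≢_)
open import Relation.Nullary using (¬_)

fromℕ : ℕ → ℚ
fromℕ n = + n / 1

-- All coordinates are rational.  In a rectangulation of a rational point set
-- within a rational rectangle every endpoint has its coordinates among those
-- of the points and of the sides of the rectangle, so working over ℚ loses no
-- rectangulation.
record Point : Set where
  constructor pt
  field
    x y : ℚ

open Point public

Btw : ℚ → ℚ → ℚ → Set
Btw u v w = (u ≤ v × v ≤ w) ⊎ (w ≤ v × v ≤ u)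

-- The closed line segment between a and b.  This is the bounding box of a and
-- b; it is only used when a and b lie on a common axis-parallel line.
_∈[_,_] : Point → Point → Point → Set
q ∈[ a , b ] = Btw (x a) (x q) (x b) × Btw (y a) (y q) (y b)

record Box : Set where
  constructor box
  field
    left right bottom top : ℚ

open Box public

_∈ᴮ_ : Point → Box → Set
q ∈ᴮ B = (left B ≤ x q × x q ≤ right B) × (bottom B ≤ y q × y q ≤ top B)

_∈ᴮ°_ : Point → Box → Set
q ∈ᴮ° B = (left B < x q × x q < right B) × (bottom B < y q × y q < top B)

_∈∂_ : Point → Box → Set
q ∈∂ B = q ∈ᴮ B × ¬ (q ∈ᴮ° B)

-- The square [-1,n]².
square : ℕ → Box
square n = box (-1ℤ / 1) (fromℕ n) (-1ℤ / 1) (fromℕ n)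

data Orientation : Set where
  horizontal vertical : Orientation

along across : Orientation → Point → ℚ
along  horizontal = x
along  vertical   = y
across horizontal = y
across vertical   = x

-- level is the constant coordinate of the segment; lo and hi bound the other.
record Segment : Set where
  constructor segment
  field
    orient      : Orientation
    level lo hi : ℚ

open Segment public

_∈ˢ_ : Point → Segment → Set
q ∈ˢ s = across (orient s) q ≡ level s
       × lo s ≤ along (orient s) q × along (orient s) q ≤ hi s

_∈ˢ°_ : Point → Segment → Set
q ∈ˢ° s = across (orient s) q ≡ level s
        × lo s < along (orient s) q × along (orient s) q < hi s

data End : Set where
  lower upper : End

other : End → End
other lower = upper
other upper = lower

endpoint : Segment → End → Point
endpoint (segment horizontal l a b) lower = pt a l
endpoint (segment horizontal l a b) upper = pt b l
endpoint (segment vertical   l a b) lower = pt l a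
endpoint (segment vertical   l a b) upper = pt l b

PointSet : ℕ → Set
PointSet n = Fin n → Point

Noncorectilinear : ∀ {n} → PointSet n → Set
Noncorectilinear P = Injective _≡_ _≡_ (x ∘ P) × Injective _≡_ _≡_ (y ∘ P)

-- F is a rectangular face of the subdivision of R by the segments: its interior
-- avoids all segments and its boundary is made up of parts of segments and of
-- the boundary of R.  The interior of such an F is a whole connected component
-- of the complement of the segments in the interior of R.
record IsFace {n} (R : Box) (seg : Fin n → Segment) (F : Box) : Set where
  field
    inside : ∀ q → q ∈ᴮ F → q ∈ᴮ R
    empty  : ∀ q → q ∈ᴮ° F → ∀ i → ¬ (q ∈ˢ seg i)
    framed : ∀ q → q ∈∂ F → q ∈∂ R ⊎ ∃[ i ] q ∈ˢ seg i

-- The segment containing P i is indexed by i.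
record Rectangulation {n} (P : PointSet n) (R : Box) : Set where
  field
    seg         : Fin n → Segment
    within      : ∀ i q → q ∈ˢ seg i → q ∈ᴮ R
    through     : ∀ i → P i ∈ˢ° seg i
    only        : ∀ i j → P j ∈ˢ seg i → j ≡ i
    noncrossing : ∀ i j → i ≢ j → ∀ q → ¬ (q ∈ˢ° seg i × q ∈ˢ° seg j)
    anchored    : ∀ i e → endpoint (seg i) e ∈∂ R
                ⊎ ∃[ j ] (orient (seg j) ≢ orient (seg i)
                         × endpoint (seg i) e ∈ˢ° seg j)
    faces       : ∀ q → q ∈ᴮ° R → (∀ i → ¬ (q ∈ˢ seg i)) →
                  ∃[ F ] (q ∈ᴮ° F × IsFace R seg F)

open Rectangulation public

module _ {n} {P : PointSet n} {R : Box} where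

  infix 4 _≈_

  _≈_ : Rectangulation P R → Rectangulation P R → Set
  r ≈ r′ = ∀ i → seg r i ≡ seg r′ i

  -- Moving from a straight to b, the first thing met after a, other than
  -- segment j, is met at b, and it is a segment of r or the boundary of R.
  record ExtendsUntil (r : Rectangulation P R) (j : Fin n) (a b : Point) : Set where
    field
      clear : ∀ q → q ∈[ a , b ] → q ≢ a → q ≢ b →
              q ∈ᴮ° R × (∀ k → k ≢ j → ¬ (q ∈ˢ seg r k))
      stop  : b ∈∂ R ⊎ ∃[ k ] (k ≢ j × b ∈ˢ seg r k)

  record Flip (r r′ : Rectangulation P R) (i : Fin n) : Set where
    field
      free   : ∀ k e → k ≢ i → ¬ (endpoint (seg r k) e ∈ˢ seg r i)
      turned : orient (seg r′ i) ≢ orient (seg r i)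
      extent : ∀ e → ExtendsUntil r i (P i) (endpoint (seg r′ i) e)
      rest   : ∀ k → k ≢ i → seg r′ k ≡ seg r k

  -- Segment i is s₁ = ab, where a is its end α, and segment j is s₂ = cd,
  -- where c is its end γ.
  record Rotate (r r′ : Rectangulation P R) (i j : Fin n) (α γ : End) : Set where
    a = endpoint (seg r i) α
    b = endpoint (seg r i) (other α)
    c = endpoint (seg r j) γ
    d = endpoint (seg r j) (other γ)
    field
      distinct  : i ≢ j
      c∈ap      : c ∈[ a , P i ]
      free      : ∀ k e → k ≢ i → k ≢ j → ¬ (endpoint (seg r k) e ∈[ a , c ])
      s₁-orient : orient (seg r′ i) ≡ orient (seg r i)
      s₁-moved  : endpoint (seg r′ i) α ≡ c
      s₁-fixed  : endpoint (seg r′ i) (other α) ≡ b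
      s₂-orient : orient (seg r′ j) ≡ orient (seg r j)
      s₂-fixed  : endpoint (seg r′ j) (other γ) ≡ d
      s₂-beyond : c ∈ˢ° seg r′ j
      s₂-extent : ExtendsUntil r j c (endpoint (seg r′ j) γ)
      rest      : ∀ k → k ≢ i → k ≢ j → seg r′ k ≡ seg r k

  data Adjacent (r r′ : Rectangulation P R) : Set where
    flip   : ∀ i → Flip r r′ i → Adjacent r r′
    rotate : ∀ i j α γ → Rotate r r′ i j α γ → Adjacent r r′

  data Walk : Rectangulation P R → Rectangulation P R → ℕ → Set where
    stay : ∀ {r s} → r ≈ s → Walk r s zero
    step : ∀ {r s t k} → Adjacent r s → Walk s t k → Walk r t (suc k)

  -- The graph distance of r and s is finite and at least d.
  DistanceAtLeast : Rectangulation P R → Rectangulation P R → ℚ → Set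
  DistanceAtLeast r s d = ∃ (Walk r s) × (∀ k → Walk r s k → d ≤ fromℕ k)

DiameterAtLeast : ∀ {n} → PointSet n → Box → ℚ → Set
DiameterAtLeast P R d =
  Σ (Rectangulation P R) λ r → Σ (Rectangulation P R) λ s → DistanceAtLeast r s d

{-# OPTIONS --safe #-}

-- The points are (rev m, m), where rev reverses the binary digits of m, so
-- that every dyadic box of area 2 ^ k contains one of them.  Call a box
-- crossed when some horizontal segment spans it from left to right, and call a
-- dyadic box of area 2 ^ (k + 1), cut by a horizontal line into two halves,
-- converted when both halves are crossed.  An operation extends a segment
-- through one face, so it newly crosses a half only around the point at which
-- the extension starts: otherwise the top or the bottom side of that face,
-- which contains no point, would have crossed the half already.  Of two newly
-- converted boxes around this point the wider one fits in height into the new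
-- half of the other one and was crossed before; hence there is only one.  But
-- k 2 ^ (k - 1) boxes are converted on the way from the lowest point having
-- the only horizontal segment to all segments being horizontal.
module Submission where

import Data.Fin as Fin
import Data.Fin.Properties as Finₚ
import Data.Integer as ℤ
import Data.Integer.Properties as ℤₚ
import Data.List.Membership.Setoid.Properties as Membershipₚ
import Data.Nat as ℕ
import Data.Nat.Coprimality as Coprimality
import Data.Nat.DivMod as DivMod
import Data.Nat.Logarithm as Logarithm
import Data.Nat.Properties as ℕₚ
import Data.Rational.Properties as ℚₚ
open import Data.Fin using (Fin; toℕ; fromℕ<)
open import Data.List using (List; []; _∷_; length)
open import Data.List.Membership.Propositional using (_∈_)
open import Data.List.Relation.Unary.Any using (here; there; index)
open import Data.Nat using (ℕ; NonZero; zero; suc)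
open import Data.Nat.Logarithm using (⌈log₂_⌉)
open import Data.Nat.Solver using (module +-*-Solver)
open import Data.Product using (Σ; ∃; ∃-syntax; _×_; _,_; proj₁; proj₂)
open import Data.Rational using (ℚ; 0ℚ; _<_; _*_; _≤_; _/_; mkℚ; *<*)
open import Data.Sum using (_⊎_; inj₁; inj₂; [_,_]′)
open import Function using (_∘_)
open import Relation.Binary.Definitions using (tri<; tri≈; tri>)
open import Relation.Binary.PropositionalEquality
open import Relation.Nullary
open import Relation.Nullary.Decidable using (_×-dec_; ¬?; toWitness)
open import Defs

-- Why pairs of halves are counted: around its starting point an extension may newly cross one half
-- of each of the k shapes, so counting crossed halves would lose the logarithm again. Asking for
-- both halves ties the shapes together, since the half that is already crossed in a wide block
-- serves as a witness for a taller and narrower one. A distance bound also asks for some walk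
-- between the two rectangulations. It is built explicitly, through a family of stages given by a
-- current row and the two ends of its segment; most of the work there is to check that every stage
-- subdivides the square into rectangles. For general n only the lowest 2 ^ k rows are bit-reversed,
-- where 2 ^ k ≤ n < 2 ^ (k + 1). The constant 1/8 absorbs this rounding and that of the logarithm.

-- Grid lines, generic coordinates and segments.

fromℕ≡mkℚ : ∀ m → fromℕ m ≡ mkℚ (ℤ.+ m) 0 (Coprimality.sym (Coprimality.1-coprimeTo m))
fromℕ≡mkℚ m = ℚₚ.normalize-coprime (Coprimality.sym (Coprimality.1-coprimeTo m))

fromℕ-mono-< : ∀ {m n} → m ℕ.< n → fromℕ m < fromℕ n
fromℕ-mono-< {m} {n} m<n rewrite fromℕ≡mkℚ m | fromℕ≡mkℚ n =
  *<* (ℤₚ.*-monoʳ-<-pos (ℤ.+ 1) (ℤ.+<+ m<n))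

fromℕ-mono-≤ : ∀ {m n} → m ℕ.≤ n → fromℕ m ≤ fromℕ n
fromℕ-mono-≤ m≤n with ℕₚ.m≤n⇒m<n∨m≡n m≤n
... | inj₁ m<n  = ℚₚ.<⇒≤ (fromℕ-mono-< m<n)
... | inj₂ refl = ℚₚ.≤-refl

fromℕ-* : ∀ m n → fromℕ m * fromℕ n ≡ fromℕ (m ℕ.* n)
fromℕ-* m n = trans (cong₂ _*_ (fromℕ≡mkℚ m) (fromℕ≡mkℚ n))
                    (cong (λ z → z / 1) (sym (ℤₚ.pos-* m n)))

-- ι m is the grid line m - 1, so that the lines from -1 on have natural indices.
abstract
  ι : ℕ → ℚ
  ι zero    = ℤ.-1ℤ / 1
  ι (suc m) = fromℕ m

  -- Besides the order of the grid lines this is all that the rest of the proof knows about `ι`: it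
  -- argues with natural indices and meets the actual rationals only to recognise the square of the
  -- theorem.
  square-ι : ∀ n → square n ≡ box (ι 0) (ι (suc n)) (ι 0) (ι (suc n))
  square-ι n = refl

  ι-mono-< : ∀ {m n} → m ℕ.< n → ι m < ι n
  ι-mono-< {zero} {suc n} _ = ℚₚ.<-≤-trans (*<* ℤ.-<+) (fromℕ-mono-≤ {0} {n} ℕ.z≤n)
  ι-mono-< {suc m} {suc n} (ℕ.s≤s m<n) = fromℕ-mono-< m<n

grid : ℕ → Box
grid n = box (ι 0) (ι (suc n)) (ι 0) (ι (suc n))

ι-mono-≤ : ∀ {m n} → m ℕ.≤ n → ι m ≤ ι n
ι-mono-≤ m≤n with ℕₚ.m≤n⇒m<n∨m≡n m≤n
... | inj₁ m<n  = ℚₚ.<⇒≤ (ι-mono-< m<n)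
... | inj₂ refl = ℚₚ.≤-refl

ι-cancel-< : ∀ {m n} → ι m < ι n → m ℕ.< n
ι-cancel-< {m} {n} p with m ℕ.<? n
... | yes m<n = m<n
... | no  m≮n = contradiction (ℚₚ.<-≤-trans p (ι-mono-≤ (ℕₚ.≮⇒≥ m≮n))) (ℚₚ.<-irrefl refl)

ι-cancel-≤ : ∀ {m n} → ι m ≤ ι n → m ℕ.≤ n
ι-cancel-≤ {m} {n} p with m ℕ.≤? n
... | yes m≤n = m≤n
... | no  m≰n = contradiction (ℚₚ.<-≤-trans (ι-mono-< (ℕₚ.≰⇒> m≰n)) p) (ℚₚ.<-irrefl refl)

ι-injective : ∀ {m n} → ι m ≡ ι n → m ≡ n
ι-injective eq = ℕₚ.≤-antisym (ι-cancel-≤ (ℚₚ.≤-reflexive eq)) (ι-cancel-≤ (ℚₚ.≤-reflexive (sym eq)))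

abstract
  -- The points lie on grid lines, so box sides placed strictly between two neighbouring ones avoid
  -- every coordinate of a point.
  κ : ℕ → ℚ
  κ m = proj₁ (ℚₚ.<-dense (ι-mono-< (ℕₚ.n<1+n m)))

  ι<κ : ∀ m → ι m < κ m
  ι<κ m = proj₁ (proj₂ (ℚₚ.<-dense (ι-mono-< (ℕₚ.n<1+n m))))

  κ<ι : ∀ m → κ m < ι (suc m)
  κ<ι m = proj₂ (proj₂ (ℚₚ.<-dense (ι-mono-< (ℕₚ.n<1+n m))))

κ-mono-≤ : ∀ {m n} → m ℕ.≤ n → κ m ≤ κ n
κ-mono-≤ {m} {n} m≤n with ℕₚ.m≤n⇒m<n∨m≡n m≤n
... | inj₁ m<n  = ℚₚ.<⇒≤ (ℚₚ.<-trans (κ<ι m) (ℚₚ.≤-<-trans (ι-mono-≤ m<n) (ι<κ n)))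
... | inj₂ refl = ℚₚ.≤-refl

κ-cancel-< : ∀ {m n} → κ m < κ n → m ℕ.< n
κ-cancel-< {m} {n} p with m ℕ.<? n
... | yes m<n = m<n
... | no  m≮n = contradiction (ℚₚ.<-≤-trans p (κ-mono-≤ (ℕₚ.≮⇒≥ m≮n))) (ℚₚ.<-irrefl refl)

κ≢ι : ∀ m n → κ m ≢ ι n
κ≢ι m n eq = ℕₚ.<⇒≱ m<n (ℕₚ.≤-pred n<1+m)
  where
  m<n : m ℕ.< n
  m<n = ι-cancel-< (subst (ι m <_) eq (ι<κ m))
  n<1+m : n ℕ.< suc m
  n<1+m = ι-cancel-< (subst (_< ι (suc m)) eq (κ<ι m))

y-endpoint : ∀ s e → orient s ≡ horizontal → y (endpoint s e) ≡ level s
y-endpoint (segment horizontal _ _ _) lower refl = refl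
y-endpoint (segment horizontal _ _ _) upper refl = refl

x-lower : ∀ s → orient s ≡ horizontal → x (endpoint s lower) ≡ lo s
x-lower (segment horizontal _ _ _) refl = refl

x-upper : ∀ s → orient s ≡ horizontal → x (endpoint s upper) ≡ hi s
x-upper (segment horizontal _ _ _) refl = refl

Btw-between : ∀ {u v w} → u ≤ w → Btw u v w → u ≤ v × v ≤ w
Btw-between u≤w (inj₁ p) = p
Btw-between u≤w (inj₂ (w≤v , v≤u)) = ℚₚ.≤-trans u≤w w≤v , ℚₚ.≤-trans v≤u u≤w

Btw-swap : ∀ {u v w} → Btw u v w → Btw w v u
Btw-swap (inj₁ p) = inj₂ p
Btw-swap (inj₂ p) = inj₁ p

_≟ᵒ_ : ∀ (o o′ : Orientation) → Dec (o ≡ o′)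
horizontal ≟ᵒ horizontal = yes refl
horizontal ≟ᵒ vertical   = no λ ()
vertical   ≟ᵒ horizontal = no λ ()
vertical   ≟ᵒ vertical   = yes refl

-- The effect of one operation on crossed boxes.

module Crossing {n} {P : PointSet n} {R : Box}
                (distinct-coords : Noncorectilinear P) (P-inside : ∀ i → P i ∈ᴮ° R) where

  Crossed : Rectangulation P R → Box → Set
  Crossed r T = ∃[ k ] (orient (seg r k) ≡ horizontal
              × (lo (seg r k) ≤ left T × right T ≤ hi (seg r k))
              × (bottom T < level (seg r k) × level (seg r k) < top T))

  crossed? : ∀ r T → Dec (Crossed r T)
  crossed? r T = Finₚ.any? λ k → (orient (seg r k) ≟ᵒ horizontal)
    ×-dec ((lo (seg r k) ℚₚ.≤? left T ×-dec right T ℚₚ.≤? hi (seg r k))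
    ×-dec (bottom T ℚₚ.<? level (seg r k) ×-dec level (seg r k) ℚₚ.<? top T))

  Crossed-mono : ∀ r {T T′} → left T′ ≤ left T → right T ≤ right T′ →
                 bottom T ≤ bottom T′ → top T′ ≤ top T → Crossed r T′ → Crossed r T
  Crossed-mono r l≤ ≤r b≤ ≤t (k , hor , (lo≤ , ≤hi) , b< , <t) =
    k , hor , (ℚₚ.≤-trans lo≤ l≤ , ℚₚ.≤-trans ≤r ≤hi) , ℚₚ.≤-<-trans b≤ b< , ℚₚ.<-≤-trans <t ≤t

  -- What the crossing argument needs of a box. A vertical segment has the abscissa of its point, so
  -- generic sides meet horizontal segments only; the resident keeps a face that spans the box in
  -- width from also spanning it in height.
  record Tile (T : Box) : Set where
    field
      proper        : left T < right T
      left-inside   : left R < left T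
      right-inside  : right T < right R
      left-generic  : ∀ k → x (P k) ≢ left T
      right-generic : ∀ k → x (P k) ≢ right T
      resident      : Fin n
      resides       : P resident ∈ᴮ° T

  open Tile

  level-through : ∀ (r : Rectangulation P R) k {o} → orient (seg r k) ≡ o → across o (P k) ≡ level (seg r k)
  level-through r k refl = proj₁ (through r k)

  P∈seg : ∀ (r : Rectangulation P R) k → P k ∈ˢ seg r k
  P∈seg r k = let (e , p , q) = through r k in e , ℚₚ.<⇒≤ p , ℚₚ.<⇒≤ q

  horizontal-through : ∀ (r : Rectangulation P R) q k → x (P k) ≢ x q → q ∈ˢ seg r k →
    orient (seg r k) ≡ horizontal × y (P k) ≡ y q × lo (seg r k) ≤ x q × x q ≤ hi (seg r k)
  horizontal-through r q k x≢ q∈ with seg r k | through r k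
  horizontal-through r q k x≢ (e , p) | segment horizontal _ _ _ | (e′ , _) = refl , trans e′ (sym e) , p
  horizontal-through r q k x≢ (e , _) | segment vertical   _ _ _ | (e′ , _) = contradiction (trans e′ (sym e)) x≢

  -- Away from the x-coordinates of the points only horizontal segments are
  -- met, and there is one at most on each level: so the side of a face is
  -- covered by a single segment.
  covered-side : ∀ (r : Rectangulation P R) {T} → Tile T → ∀ t → bottom T < t → t < top T →
    (∃[ k ] pt (left T) t ∈ˢ seg r k) → (∃[ k ] pt (right T) t ∈ˢ seg r k) → Crossed r T
  covered-side r tile t b<t t<t (k , kˡ) (k′ , kʳ)
    with horizontal-through r _ k (left-generic tile k) kˡ
       | horizontal-through r _ k′ (right-generic tile k′) kʳ
  ... | hor , yk , lo≤ , _ | _ , yk′ , _ , ≤hi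
    with proj₂ distinct-coords (trans yk (sym yk′))
  ... | refl = k , hor , (lo≤ , ≤hi) , subst (_ <_) lev b<t , subst (_< _) lev t<t
    where lev = trans (sym yk) (level-through r k hor)

  -- The face through which the run from (c, ℓ) to (b, ℓ) passes spans the
  -- tile horizontally but not its resident, so its top or bottom side crosses
  -- the tile.
  run-crossed : ∀ (r : Rectangulation P R) {c b ℓ} →
    (∀ u → c < u → u < b → pt u ℓ ∈ᴮ° R × (∀ k → ¬ (pt u ℓ ∈ˢ seg r k))) →
    ∀ {T} → Tile T → c ≤ left T → right T ≤ b → bottom T < ℓ → ℓ < top T → Crossed r T
  run-crossed r {c} {b} {ℓ} clear {T} tile c≤l r≤b b<ℓ ℓ<t
    with ℚₚ.<-dense (proper tile)
  ... | m , l<m , m<r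
    with clear m (ℚₚ.≤-<-trans c≤l l<m) (ℚₚ.<-≤-trans m<r r≤b)
  ... | m∈R , m∉
    with faces r (pt m ℓ) m∈R m∉
  ... | F , ((Fl<m , m<Fr) , Fb<ℓ , ℓ<Ft) , face = crossing
    where
    open IsFace face
    z = resident tile

    -- The run avoids all segments and the boundary of `R`, hence also the boundary of every face.
    -- Being contradictory, this case yields any conclusion; so `F` reaches both ends of the run.
    side : ∀ {u} → c < u → u < b → pt u ℓ ∈∂ F → Crossed r T
    side c<u u<b u∈∂F with clear _ c<u u<b | framed _ u∈∂F
    ... | u∈R , _  | inj₁ (_ , u∉R) = contradiction u∈R u∉R
    ... | _   , u∉ | inj₂ (k , u∈k) = contradiction u∈k (u∉ k)

    Fl≤Fr : left F ≤ right F
    Fl≤Fr = ℚₚ.<⇒≤ (ℚₚ.<-trans Fl<m m<Fr)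

    Fb≤Ft : bottom F ≤ top F
    Fb≤Ft = ℚₚ.<⇒≤ (ℚₚ.<-trans Fb<ℓ ℓ<Ft)

    ℓ∈F = ℚₚ.<⇒≤ Fb<ℓ , ℚₚ.<⇒≤ ℓ<Ft

    left≤c : Crossed r T ⊎ left F ≤ c
    left≤c with left F ℚₚ.≤? c
    ... | yes p = inj₂ p
    ... | no ¬p = inj₁ (side (ℚₚ.≰⇒> ¬p) (ℚₚ.<-trans Fl<m (ℚₚ.<-≤-trans m<r r≤b))
                   (((ℚₚ.≤-refl , Fl≤Fr) , ℓ∈F) , λ q → ℚₚ.<-irrefl refl (proj₁ (proj₁ q))))

    b≤right : Crossed r T ⊎ b ≤ right F
    b≤right with b ℚₚ.≤? right F
    ... | yes p = inj₂ p
    ... | no ¬p = inj₁ (side (ℚₚ.≤-<-trans c≤l (ℚₚ.<-trans l<m m<Fr)) (ℚₚ.≰⇒> ¬p)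
                   (((Fl≤Fr , ℚₚ.≤-refl) , ℓ∈F) , λ q → ℚₚ.<-irrefl refl (proj₂ (proj₁ q))))

    spanned : left F ≤ c → b ≤ right F → Crossed r T
    spanned Fl≤c b≤Fr = conclude
      where
      Fl≤l = ℚₚ.≤-trans Fl≤c c≤l
      r≤Fr = ℚₚ.≤-trans r≤b b≤Fr
      l≤r = ℚₚ.<⇒≤ (proper tile)

      at-level : ∀ t → bottom T < t → t < top T → bottom R < t → t < top R →
                 (∀ u → left F ≤ u → u ≤ right F → pt u t ∈∂ F) → Crossed r T
      at-level t b<t t<t Rb<t t<Rt ∂ = covered-side r tile t b<t t<t
          (meets (left T) ℚₚ.≤-refl l≤r) (meets (right T) l≤r ℚₚ.≤-refl)
        where
        meets : ∀ u → left T ≤ u → u ≤ right T → ∃[ k ] pt u t ∈ˢ seg r k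
        meets u l≤u u≤r with framed _ (∂ u (ℚₚ.≤-trans Fl≤l l≤u) (ℚₚ.≤-trans u≤r r≤Fr))
        ... | inj₂ k = k
        ... | inj₁ (_ , u∉R) = contradiction
          ((ℚₚ.<-≤-trans (left-inside tile) l≤u , ℚₚ.≤-<-trans u≤r (right-inside tile)) , Rb<t , t<Rt) u∉R

      conclude : Crossed r T
      -- A side of `F` between the level `ℓ` and the resident lies within the height of `T`. Without
      -- such a side the resident would be interior to `F`, but its own segment passes through it.
      conclude with top F ℚₚ.≤? y (P z) | y (P z) ℚₚ.≤? bottom F
      ... | yes Ft≤z | _ = at-level (top F)
        (ℚₚ.<-trans b<ℓ ℓ<Ft) (ℚₚ.≤-<-trans Ft≤z (proj₂ (proj₂ (resides tile))))
        (ℚₚ.<-trans (proj₁ (proj₂ m∈R)) ℓ<Ft) (ℚₚ.≤-<-trans Ft≤z (proj₂ (proj₂ (P-inside z))))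
        (λ u p q → ((p , q) , Fb≤Ft , ℚₚ.≤-refl) , λ u∈ → ℚₚ.<-irrefl refl (proj₂ (proj₂ u∈)))
      ... | no _ | yes z≤Fb = at-level (bottom F)
        (ℚₚ.<-≤-trans (proj₁ (proj₂ (resides tile))) z≤Fb) (ℚₚ.<-trans Fb<ℓ ℓ<t)
        (ℚₚ.<-≤-trans (proj₁ (proj₂ (P-inside z))) z≤Fb) (ℚₚ.<-trans Fb<ℓ (proj₂ (proj₂ m∈R)))
        (λ u p q → ((p , q) , ℚₚ.≤-refl , Fb≤Ft) , λ u∈ → ℚₚ.<-irrefl refl (proj₁ (proj₂ u∈)))
      ... | no Ft≰z | no z≰Fb = contradiction (P∈seg r z) (empty (P z)
        ((ℚₚ.≤-<-trans Fl≤l (proj₁ (proj₁ (resides tile))) , ℚₚ.<-≤-trans (proj₂ (proj₁ (resides tile))) r≤Fr)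
        , ℚₚ.≰⇒> z≰Fb , ℚₚ.≰⇒> Ft≰z) z)

    crossing : Crossed r T
    crossing with left≤c | b≤right
    ... | inj₁ p | _ = p
    ... | inj₂ _ | inj₁ p = p
    ... | inj₂ p | inj₂ q = spanned p q

  horizontal-extent : ∀ (r : Rectangulation P R) i → orient (seg r i) ≡ horizontal →
    lo (seg r i) ≤ x (P i) × x (P i) ≤ hi (seg r i)
  horizontal-extent r i hor with seg r i | P∈seg r i
  horizontal-extent r i refl | segment horizontal _ _ _ | _ , p = p

  ∈horizontal : ∀ (s : Segment) q → orient s ≡ horizontal → q ∈ˢ s → lo s ≤ x q × x q ≤ hi s
  ∈horizontal (segment horizontal _ _ _) q refl (_ , p) = p

  -- `ExtendsUntil` exempts segment `j` itself. The last hypothesis, that `j` does not yet occupy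
  -- the run, closes this gap and gives the form that `run-crossed` expects.
  extension-right : ∀ {r : Rectangulation P R} {j a b} → ExtendsUntil r j a b → y b ≡ y a →
    (∀ u → x a < u → u < x b → ¬ (pt u (y a) ∈ˢ seg r j)) →
    ∀ u → x a < u → u < x b → pt u (y a) ∈ᴮ° R × (∀ k → ¬ (pt u (y a) ∈ˢ seg r k))
  extension-right {r} {j} ext yb≡ya ∉j u a<u u<b = proj₁ c , ∉k
    where
    c = ExtendsUntil.clear ext (pt u _) (inj₁ (ℚₚ.<⇒≤ a<u , ℚₚ.<⇒≤ u<b) , inj₁ (ℚₚ.≤-refl , ℚₚ.≤-reflexive (sym yb≡ya)))
          (λ e → ℚₚ.<-irrefl (sym (cong x e)) a<u) (λ e → ℚₚ.<-irrefl (cong x e) u<b)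
    ∉k : ∀ k → ¬ (pt u _ ∈ˢ seg r k)
    ∉k k with k Finₚ.≟ j
    ... | yes refl = ∉j u a<u u<b
    ... | no k≢j   = proj₂ c k k≢j

  extension-left : ∀ {r : Rectangulation P R} {j a b} → ExtendsUntil r j a b → y b ≡ y a →
    (∀ u → x b < u → u < x a → ¬ (pt u (y a) ∈ˢ seg r j)) →
    ∀ u → x b < u → u < x a → pt u (y a) ∈ᴮ° R × (∀ k → ¬ (pt u (y a) ∈ˢ seg r k))
  extension-left {r} {j} ext yb≡ya ∉j u b<u u<a = proj₁ c , ∉k
    where
    c = ExtendsUntil.clear ext (pt u _) (inj₂ (ℚₚ.<⇒≤ b<u , ℚₚ.<⇒≤ u<a) , inj₁ (ℚₚ.≤-refl , ℚₚ.≤-reflexive (sym yb≡ya)))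
          (λ e → ℚₚ.<-irrefl (cong x e) u<a) (λ e → ℚₚ.<-irrefl (sym (cong x e)) b<u)
    ∉k : ∀ k → ¬ (pt u _ ∈ˢ seg r k)
    ∉k k with k Finₚ.≟ j
    ... | yes refl = ∉j u b<u u<a
    ... | no k≢j   = proj₂ c k k≢j

  -- One point `c` serves all tiles at once: therefore any two tiles newly crossed by the same
  -- operation overlap around it.
  Pivot : Rectangulation P R → Rectangulation P R → Point → Set
  Pivot r r′ c = ∀ {T} → Tile T → Crossed r′ T → Crossed r T ⊎ c ∈ᴮ° T

  crossed-unmoved : ∀ (r r′ : Rectangulation P R) {T} k → seg r′ k ≡ seg r k → orient (seg r′ k) ≡ horizontal →
    lo (seg r′ k) ≤ left T × right T ≤ hi (seg r′ k) →
    bottom T < level (seg r′ k) × level (seg r′ k) < top T → Crossed r T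
  crossed-unmoved r r′ k eq hor p q rewrite eq = k , hor , p , q

  flip-pivot : ∀ {r r′ : Rectangulation P R} {i} → Flip r r′ i → Pivot r r′ (P i)
  flip-pivot {r} {r′} {i} fl {T} tile (k , hor , (lo≤ , ≤hi) , b< , <t) with k Finₚ.≟ i
  ... | no k≢i = inj₁ (crossed-unmoved r r′ k (Flip.rest fl k k≢i) hor (lo≤ , ≤hi) (b< , <t))
  ... | yes refl = turned-crossing (x (P i) ℚₚ.≤? left T) (right T ℚₚ.≤? x (P i))
    where
    open Flip fl
    yₑ : ∀ e → y (endpoint (seg r′ i) e) ≡ y (P i)
    yₑ e = trans (y-endpoint _ e hor) (sym (level-through r′ i hor))
    b<y = subst (bottom T <_) (sym (level-through r′ i hor)) b<
    y<t = subst (_< top T) (sym (level-through r′ i hor)) <t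
    -- Segment `i` was vertical before the flip, so on the row of `P i` it occupies that point only
    -- and leaves the runs to both sides free.
    upright : ∀ u → x (P i) ≢ u → ¬ (pt u (y (P i)) ∈ˢ seg r i)
    upright u x≢u u∈ = turned (trans hor (sym (proj₁ (horizontal-through r _ i x≢u u∈))))
    turned-crossing : Dec (x (P i) ≤ left T) → Dec (right T ≤ x (P i)) → Crossed r T ⊎ P i ∈ᴮ° T
    turned-crossing (yes p≤l) _ = inj₁ (run-crossed r
      (extension-right (extent upper) (yₑ upper) λ u p<u _ → upright u λ e → ℚₚ.<-irrefl e p<u)
      tile p≤l (subst (right T ≤_) (sym (x-upper _ hor)) ≤hi) b<y y<t)
    turned-crossing (no _) (yes r≤p) = inj₁ (run-crossed r
      (extension-left (extent lower) (yₑ lower) λ u _ u<p → upright u λ e → ℚₚ.<-irrefl (sym e) u<p)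
      tile (subst (_≤ left T) (sym (x-lower _ hor)) lo≤) r≤p b<y y<t)
    turned-crossing (no p≰l) (no r≰p) = inj₂ ((ℚₚ.≰⇒> p≰l , ℚₚ.≰⇒> r≰p) , b<y , y<t)

  rotate-pivot : ∀ {r r′ : Rectangulation P R} {i j α γ} → Rotate r r′ i j α γ → Pivot r r′ (endpoint (seg r j) γ)
  rotate-pivot {r} {r′} {i} {j} {α} {γ} rot {T} tile (k , hor , (lo≤ , ≤hi) , b< , <t)
    with k Finₚ.≟ i | k Finₚ.≟ j
  ... | no k≢i | no k≢j = inj₁ (crossed-unmoved r r′ k (Rotate.rest rot k k≢i k≢j) hor (lo≤ , ≤hi) (b< , <t))
  -- As `c` lies between `a` and `P i`, the shortened segment is part of the old one and crosses
  -- nothing new.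
  ... | yes refl | _ = inj₁ (shortened α s₁-moved s₁-fixed c∈ap)
    where
    open Rotate rot hiding (a ; b ; c ; d)
    hor₀ = trans (sym s₁-orient) hor
    lev : level (seg r′ i) ≡ level (seg r i)
    lev = trans (sym (level-through r′ i hor)) (level-through r i hor₀)
    ext = horizontal-extent r i hor₀
    cut : lo (seg r i) ≤ left T → right T ≤ hi (seg r i) → Crossed r T
    cut p q = i , hor₀ , (p , q) , subst (bottom T <_) lev b< , subst (_< top T) lev <t
    shortened : ∀ α {c} → endpoint (seg r′ i) α ≡ c →
      endpoint (seg r′ i) (other α) ≡ endpoint (seg r i) (other α) →
      c ∈[ endpoint (seg r i) α , P i ] → Crossed r T
    shortened lower refl fixed (c∈ , _) = cut
      (ℚₚ.≤-trans (subst₂ _≤_ (x-lower _ hor₀) (x-lower _ hor)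
        (proj₁ (Btw-between (subst (_≤ _) (sym (x-lower _ hor₀)) (proj₁ ext)) c∈))) lo≤)
      (subst (right T ≤_) (trans (sym (x-upper _ hor)) (trans (cong x fixed) (x-upper _ hor₀))) ≤hi)
    shortened upper refl fixed (c∈ , _) = cut
      (subst (_≤ left T) (trans (sym (x-lower _ hor)) (trans (cong x fixed) (x-lower _ hor₀))) lo≤)
      (ℚₚ.≤-trans ≤hi (subst₂ _≤_ (x-upper _ hor) (x-upper _ hor₀)
        (proj₂ (Btw-between (subst (_ ≤_) (sym (x-upper _ hor₀)) (proj₂ ext)) (Btw-swap c∈)))))
  ... | no _ | yes refl = lengthened γ s₂-fixed s₂-extent
    where
    open Rotate rot hiding (a ; b ; c ; d)
    hor₀ = trans (sym s₂-orient) hor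
    lev : level (seg r′ j) ≡ level (seg r j)
    lev = trans (sym (level-through r′ j hor)) (level-through r j hor₀)
    yₑ : ∀ e → y (endpoint (seg r j) e) ≡ level (seg r′ j)
    yₑ e = trans (y-endpoint _ e hor₀) (sym lev)
    yₑ′ : ∀ e → y (endpoint (seg r′ j) e) ≡ y (endpoint (seg r j) e)
    yₑ′ e = trans (y-endpoint _ e hor) (sym (yₑ e))
    b<y : ∀ e → bottom T < y (endpoint (seg r j) e)
    b<y e = subst (bottom T <_) (sym (yₑ e)) b<
    y<t : ∀ e → y (endpoint (seg r j) e) < top T
    y<t e = subst (_< top T) (sym (yₑ e)) <t
    old : lo (seg r j) ≤ left T → right T ≤ hi (seg r j) → Crossed r T
    old p q = j , hor₀ , (p , q) , subst (bottom T <_) lev b< , subst (_< top T) lev <t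
    -- A tile beyond `c` is spanned by the added run, a tile before `c` by the old segment; every
    -- other one has `c` strictly between its left and right sides.
    lengthened : ∀ γ → endpoint (seg r′ j) (other γ) ≡ endpoint (seg r j) (other γ) →
      ExtendsUntil r j (endpoint (seg r j) γ) (endpoint (seg r′ j) γ) →
      Crossed r T ⊎ endpoint (seg r j) γ ∈ᴮ° T
    lengthened upper fixed ext with x (endpoint (seg r j) upper) ℚₚ.≤? left T | right T ℚₚ.≤? x (endpoint (seg r j) upper)
    ... | yes c≤l | _ = inj₁ (run-crossed r
          (extension-right ext (yₑ′ upper) λ u c<u _ u∈ → ℚₚ.<-irrefl refl
             (ℚₚ.<-≤-trans c<u (subst (u ≤_) (sym (x-upper _ hor₀)) (proj₂ (∈horizontal _ _ hor₀ u∈)))))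
          tile c≤l (subst (right T ≤_) (sym (x-upper _ hor)) ≤hi) (b<y upper) (y<t upper))
    ... | no _ | yes r≤c = inj₁ (old
          (subst (_≤ left T) (trans (sym (x-lower _ hor)) (trans (cong x fixed) (x-lower _ hor₀))) lo≤)
          (subst (right T ≤_) (x-upper _ hor₀) r≤c))
    ... | no c≰l | no r≰c = inj₂ ((ℚₚ.≰⇒> c≰l , ℚₚ.≰⇒> r≰c) , b<y upper , y<t upper)
    lengthened lower fixed ext with x (endpoint (seg r j) lower) ℚₚ.≤? left T | right T ℚₚ.≤? x (endpoint (seg r j) lower)
    ... | _ | yes r≤c = inj₁ (run-crossed r
          (extension-left ext (yₑ′ lower) λ u _ u<c u∈ → ℚₚ.<-irrefl refl
             (ℚₚ.<-≤-trans u<c (subst (_≤ u) (sym (x-lower _ hor₀)) (proj₁ (∈horizontal _ _ hor₀ u∈)))))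
          tile (subst (_≤ left T) (sym (x-lower _ hor)) lo≤) r≤c (b<y lower) (y<t lower))
    ... | yes c≤l | no _ = inj₁ (old
          (subst (_≤ left T) (x-lower _ hor₀) c≤l)
          (subst (right T ≤_) (trans (sym (x-upper _ hor)) (trans (cong x fixed) (x-upper _ hor₀))) ≤hi))
    ... | no c≰l | no r≰c = inj₂ ((ℚₚ.≰⇒> c≰l , ℚₚ.≰⇒> r≰c) , b<y lower , y<t lower)

  pivot : ∀ {r r′ : Rectangulation P R} → Adjacent r r′ → ∃ (Pivot r r′)
  pivot (flip i fl)              = P i , flip-pivot fl
  pivot (rotate i j α γ rot) = _ , rotate-pivot rot

-- Digit reversal and dyadic intervals.

digits-< : ∀ {q r a s} → q ℕ.< a → r ℕ.< s → q ℕ.* s ℕ.+ r ℕ.< a ℕ.* s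
digits-< {q} {r} {a} {s} q<a r<s = begin-strict
  q ℕ.* s ℕ.+ r <⟨ ℕₚ.+-monoʳ-< (q ℕ.* s) r<s ⟩
  q ℕ.* s ℕ.+ s ≡⟨ ℕₚ.+-comm (q ℕ.* s) s ⟩
  suc q ℕ.* s   ≤⟨ ℕₚ.*-monoˡ-≤ s q<a ⟩
  a ℕ.* s       ∎
  where open ℕₚ.≤-Reasoning

digits-unique : ∀ {q q′ r r′ s} → r ℕ.< s → r′ ℕ.< s →
                q ℕ.* s ℕ.+ r ≡ q′ ℕ.* s ℕ.+ r′ → q ≡ q′ × r ≡ r′
digits-unique {q} {q′} {r} {r′} {s} r<s r′<s eq with ℕₚ.<-cmp q q′
... | tri< q<q′ _ _ = contradiction (ℕₚ.<-≤-trans (digits-< q<q′ r<s) (ℕₚ.m≤m+n _ r′)) (ℕₚ.<-irrefl eq)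
... | tri> _ _ q′<q = contradiction (ℕₚ.<-≤-trans (digits-< q′<q r′<s) (ℕₚ.m≤m+n _ r)) (ℕₚ.<-irrefl (sym eq))
... | tri≈ _ refl _ = refl , ℕₚ.+-cancelˡ-≡ (q ℕ.* s) r r′ eq

-- Exactly `u` binary digits are read, leading zeros included and higher digits dropped; hence the
-- range conditions wherever injectivity is needed.
reverse : ℕ → ℕ → ℕ
reverse zero    c = 0
reverse (suc u) c = (c ℕ.% 2) ℕ.* 2 ℕ.^ u ℕ.+ reverse u (c ℕ./ 2)

reverse-< : ∀ u c → reverse u c ℕ.< 2 ℕ.^ u
reverse-< zero    c = ℕₚ.≤-refl
reverse-< (suc u) c = digits-< (DivMod.m%n<n c 2) (reverse-< u (c ℕ./ 2))

reverse-injective : ∀ u {c c′} → c ℕ.< 2 ℕ.^ u → c′ ℕ.< 2 ℕ.^ u → reverse u c ≡ reverse u c′ → c ≡ c′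
reverse-injective zero    {c} {c′} c< c′< _ = trans (ℕₚ.n<1⇒n≡0 c<) (sym (ℕₚ.n<1⇒n≡0 c′<))
reverse-injective (suc u) {c} {c′} c< c′< eq =
  let (lo≡ , hi≡) = digits-unique (reverse-< u (c ℕ./ 2)) (reverse-< u (c′ ℕ./ 2)) eq
      halves≡ = reverse-injective u (half c c<) (half c′ c′<) hi≡
  in trans (DivMod.m≡m%n+[m/n]*n c 2)
      (trans (cong₂ (λ p q → p ℕ.+ q ℕ.* 2) lo≡ halves≡) (sym (DivMod.m≡m%n+[m/n]*n c′ 2)))
  where
  half : ∀ m → m ℕ.< 2 ℕ.^ suc u → m ℕ./ 2 ℕ.< 2 ℕ.^ u
  half m m< = DivMod.m<n*o⇒m/o<n (subst (m ℕ.<_) (ℕₚ.*-comm 2 (2 ℕ.^ u)) m<)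

-- Reversing a concatenation reverses both parts and exchanges them. Here `b` selects an interval of
-- 2 ^ u rows and `c` an interval of 2 ^ v columns, so the equation locates a point in the dyadic
-- box where they meet.
reverse-split : ∀ u v b {c} → c ℕ.< 2 ℕ.^ u →
  reverse (u ℕ.+ v) (b ℕ.* 2 ℕ.^ u ℕ.+ c) ≡ reverse u c ℕ.* 2 ℕ.^ v ℕ.+ reverse v b
reverse-split zero    v b {c} c< = cong (reverse v) (trans
  (cong₂ ℕ._+_ (ℕₚ.*-identityʳ b) (ℕₚ.n<1⇒n≡0 c<)) (ℕₚ.+-identityʳ b))
reverse-split (suc u) v b {c} c< = begin
  (m ℕ.% 2) ℕ.* 2 ℕ.^ (u ℕ.+ v) ℕ.+ reverse (u ℕ.+ v) (m ℕ./ 2)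
    ≡⟨ cong₂ (λ p q → p ℕ.* 2 ℕ.^ (u ℕ.+ v) ℕ.+ reverse (u ℕ.+ v) q) m%2 m/2 ⟩
  (c ℕ.% 2) ℕ.* 2 ℕ.^ (u ℕ.+ v) ℕ.+ reverse (u ℕ.+ v) (b ℕ.* 2 ℕ.^ u ℕ.+ c ℕ./ 2)
    ≡⟨ cong₂ ℕ._+_ (trans (cong ((c ℕ.% 2) ℕ.*_) (ℕₚ.^-distribˡ-+-* 2 u v)) (sym (ℕₚ.*-assoc (c ℕ.% 2) (2 ℕ.^ u) (2 ℕ.^ v))))
                   (reverse-split u v b (DivMod.m<n*o⇒m/o<n (subst (c ℕ.<_) (ℕₚ.*-comm 2 (2 ℕ.^ u)) c<))) ⟩
  (c ℕ.% 2) ℕ.* 2 ℕ.^ u ℕ.* 2 ℕ.^ v ℕ.+ (reverse u (c ℕ./ 2) ℕ.* 2 ℕ.^ v ℕ.+ reverse v b)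
    ≡⟨ ℕₚ.+-assoc ((c ℕ.% 2) ℕ.* 2 ℕ.^ u ℕ.* 2 ℕ.^ v) _ (reverse v b) ⟨
  (c ℕ.% 2) ℕ.* 2 ℕ.^ u ℕ.* 2 ℕ.^ v ℕ.+ reverse u (c ℕ./ 2) ℕ.* 2 ℕ.^ v ℕ.+ reverse v b
    ≡⟨ cong (ℕ._+ reverse v b) (ℕₚ.*-distribʳ-+ (2 ℕ.^ v) ((c ℕ.% 2) ℕ.* 2 ℕ.^ u) _) ⟨
  reverse (suc u) c ℕ.* 2 ℕ.^ v ℕ.+ reverse v b ∎
  where
  open ≡-Reasoning
  m = b ℕ.* 2 ℕ.^ suc u ℕ.+ c
  even : b ℕ.* 2 ℕ.^ suc u ≡ (b ℕ.* 2 ℕ.^ u) ℕ.* 2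
  even = trans (cong (b ℕ.*_) (ℕₚ.*-comm 2 (2 ℕ.^ u))) (sym (ℕₚ.*-assoc b _ 2))
  m≡ : m ≡ c ℕ.% 2 ℕ.+ (b ℕ.* 2 ℕ.^ u ℕ.+ c ℕ./ 2) ℕ.* 2
  m≡ = begin
    b ℕ.* 2 ℕ.^ suc u ℕ.+ c
      ≡⟨ cong₂ ℕ._+_ even (DivMod.m≡m%n+[m/n]*n c 2) ⟩
    (b ℕ.* 2 ℕ.^ u) ℕ.* 2 ℕ.+ (c ℕ.% 2 ℕ.+ c ℕ./ 2 ℕ.* 2)
      ≡⟨ solve 3 (λ p q r → p :* con 2 :+ (q :+ r :* con 2) := q :+ (p :+ r) :* con 2) refl (b ℕ.* 2 ℕ.^ u) (c ℕ.% 2) (c ℕ./ 2) ⟩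
    c ℕ.% 2 ℕ.+ (b ℕ.* 2 ℕ.^ u ℕ.+ c ℕ./ 2) ℕ.* 2 ∎
    where open import Data.Nat.Solver using (module +-*-Solver)
          open +-*-Solver
  m%2 : m ℕ.% 2 ≡ c ℕ.% 2
  m%2 = trans (cong (ℕ._% 2) m≡) (trans (DivMod.[m+kn]%n≡m%n (c ℕ.% 2) (b ℕ.* 2 ℕ.^ u ℕ.+ c ℕ./ 2) 2) (DivMod.m%n%n≡m%n c 2))
  m/2 : m ℕ./ 2 ≡ b ℕ.* 2 ℕ.^ u ℕ.+ c ℕ./ 2
  m/2 = ℕₚ.*-cancelʳ-≡ _ _ 2 (ℕₚ.+-cancelˡ-≡ (c ℕ.% 2) _ _
    (trans (cong (ℕ._+ m ℕ./ 2 ℕ.* 2) (sym m%2)) (trans (sym (DivMod.m≡m%n+[m/n]*n m 2)) m≡)))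

-- The ends of the longer interval are multiples of the shorter length, so none of them falls
-- strictly inside the shorter interval, and a common point `q` forces inclusion.
dyadic-nested : ∀ {q a a′ s w} → κ (a ℕ.* s) < q → q < κ (suc a ℕ.* s) →
  κ (a′ ℕ.* (w ℕ.* s)) < q → q < κ (suc a′ ℕ.* (w ℕ.* s)) →
  a′ ℕ.* (w ℕ.* s) ℕ.≤ a ℕ.* s × suc a ℕ.* s ℕ.≤ suc a′ ℕ.* (w ℕ.* s)
dyadic-nested {q} {a} {a′} {s} {w} l r l′ r′ =
    subst (ℕ._≤ a ℕ.* s) (ℕₚ.*-assoc a′ w s) (ℕₚ.*-monoˡ-≤ s (ℕₚ.≤-pred (ℕₚ.*-cancelʳ-< s (a′ ℕ.* w) (suc a)
      (subst (ℕ._< suc a ℕ.* s) (sym (ℕₚ.*-assoc a′ w s)) (κ-cancel-< (ℚₚ.<-trans l′ r))))))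
  , subst (suc a ℕ.* s ℕ.≤_) (ℕₚ.*-assoc (suc a′) w s) (ℕₚ.*-monoˡ-≤ s (ℕₚ.*-cancelʳ-< s a (suc a′ ℕ.* w)
      (subst (a ℕ.* s ℕ.<_) (sym (ℕₚ.*-assoc (suc a′) w s)) (κ-cancel-< (ℚₚ.<-trans l r′)))))

dyadic-unique : ∀ {q a a′ s} → κ (a ℕ.* s) < q → q < κ (suc a ℕ.* s) →
  κ (a′ ℕ.* s) < q → q < κ (suc a′ ℕ.* s) → a ≡ a′
dyadic-unique {a = a} {a′} {s} l r l′ r′ = ℕₚ.≤-antisym
  (ℕₚ.≤-pred (ℕₚ.*-cancelʳ-< s a (suc a′) (κ-cancel-< (ℚₚ.<-trans l r′))))
  (ℕₚ.≤-pred (ℕₚ.*-cancelʳ-< s a′ (suc a) (κ-cancel-< (ℚₚ.<-trans l′ r))))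

2^-split : ∀ {p q} → p ℕ.≤ q → 2 ℕ.^ q ≡ 2 ℕ.^ (q ℕ.∸ p) ℕ.* 2 ℕ.^ p
2^-split {p} {q} p≤q = trans (cong (2 ℕ.^_) (sym (ℕₚ.m∸n+n≡m p≤q))) (ℕₚ.^-distribˡ-+-* 2 (q ℕ.∸ p) p)

-- Distinct elements sit at distinct positions, so repetitions in the list do no harm.
covering-list : ∀ {m} (xs : List (Fin m)) → (∀ i → i ∈ xs) → m ℕ.≤ length xs
covering-list xs all = Finₚ.injective⇒≤ {f = λ i → index (all i)}
  (λ {i} {j} → Membershipₚ.index-injective (setoid _) (all i) (all j))

-- The point set, its blocks and the lower bound on walks.

module BitReversal (k n : ℕ) (2^k≤n : 2 ℕ.^ k ℕ.≤ n) where

  -- Reversal permutes the numbers below 2 ^ k, so the remaining points can go on the diagonal: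
  -- there they keep all coordinates distinct and stay outside the dyadic boxes that are counted.
  column : ℕ → ℕ
  column m with m ℕ.<? 2 ℕ.^ k
  ... | yes _ = reverse k m
  ... | no  _ = m

  column-reversed : ∀ {m} → m ℕ.< 2 ℕ.^ k → column m ≡ reverse k m
  column-reversed {m} m< with m ℕ.<? 2 ℕ.^ k
  ... | yes _ = refl
  ... | no m≮ = contradiction m< m≮

  column-< : ∀ {m} → m ℕ.< n → column m ℕ.< n
  column-< {m} m<n with m ℕ.<? 2 ℕ.^ k
  ... | yes _ = ℕₚ.<-≤-trans (reverse-< k m) 2^k≤n
  ... | no  _ = m<n

  column-injective : ∀ {m m′} → column m ≡ column m′ → m ≡ m′
  column-injective {m} {m′} eq with m ℕ.<? 2 ℕ.^ k | m′ ℕ.<? 2 ℕ.^ k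
  ... | yes p | yes q = reverse-injective k p q eq
  ... | yes _ | no  q = contradiction (subst (ℕ._< 2 ℕ.^ k) eq (reverse-< k m)) q
  ... | no  p | yes _ = contradiction (subst (ℕ._< 2 ℕ.^ k) (sym eq) (reverse-< k m′)) p
  ... | no  _ | no  _ = eq

  points : PointSet n
  points i = pt (ι (suc (column (toℕ i)))) (ι (suc (toℕ i)))

  noncorectilinear : Noncorectilinear points
  noncorectilinear =
      (λ {i} {j} eq → Finₚ.toℕ-injective (column-injective
        (ℕₚ.suc-injective (ι-injective {suc (column (toℕ i))} {suc (column (toℕ j))} eq))))
    , (λ {i} {j} eq → Finₚ.toℕ-injective (ℕₚ.suc-injective (ι-injective {suc (toℕ i)} {suc (toℕ j)} eq)))

  ι-inside : ∀ {m} → m ℕ.< n → left (grid n) < ι (suc m) × ι (suc m) < right (grid n)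
  ι-inside {m} m<n = ι-mono-< {0} {suc m} (ℕ.s≤s ℕ.z≤n) , ι-mono-< {suc m} {suc n} (ℕ.s≤s m<n)

  points-inside : ∀ i → points i ∈ᴮ° grid n
  points-inside i = ι-inside (column-< (Finₚ.toℕ<n i)) , ι-inside (Finₚ.toℕ<n i)

  open Crossing {P = points} {R = grid n} noncorectilinear points-inside

  dyadicBox : (v u a b : ℕ) → Box
  dyadicBox v u a b = box (κ (a ℕ.* 2 ℕ.^ v)) (κ (suc a ℕ.* 2 ℕ.^ v)) (κ (b ℕ.* 2 ℕ.^ u)) (κ (suc b ℕ.* 2 ℕ.^ u))

  -- Since `ι (suc m)` is the coordinate `m`, the line `κ m` lies just before it; the cell thus
  -- holds the `s` coordinates starting with `a ℕ.* s`.
  κ-cell : ∀ a {r s} → r ℕ.< s → κ (a ℕ.* s) < ι (suc (a ℕ.* s ℕ.+ r)) × ι (suc (a ℕ.* s ℕ.+ r)) < κ (suc a ℕ.* s)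
  κ-cell a {r} {s} r<s =
      ℚₚ.<-≤-trans (κ<ι (a ℕ.* s)) (ι-mono-≤ (ℕ.s≤s (ℕₚ.m≤m+n _ r)))
    , ℚₚ.≤-<-trans (ι-mono-≤ (digits-< {a} {r} {suc a} {s} ℕₚ.≤-refl r<s)) (ι<κ (suc a ℕ.* s))

  module _ {u v : ℕ} (u+v≡k : u ℕ.+ v ≡ k) where

    row-< : ∀ {b c} → b ℕ.< 2 ℕ.^ v → c ℕ.< 2 ℕ.^ u → b ℕ.* 2 ℕ.^ u ℕ.+ c ℕ.< 2 ℕ.^ k
    row-< b< c< = subst (_ ℕ.<_)
      (trans (sym (ℕₚ.^-distribˡ-+-* 2 v u)) (cong (2 ℕ.^_) (trans (ℕₚ.+-comm v u) u+v≡k)))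
      (digits-< b< c<)

    resident-column : ∀ {b c} → b ℕ.< 2 ℕ.^ v → c ℕ.< 2 ℕ.^ u →
      column (b ℕ.* 2 ℕ.^ u ℕ.+ c) ≡ reverse u c ℕ.* 2 ℕ.^ v ℕ.+ reverse v b
    resident-column {b} b< c< = trans (column-reversed (row-< b< c<))
      (trans (cong (λ w → reverse w _) (sym u+v≡k)) (reverse-split u v b c<))

    -- Indexing the column interval by `reverse u c` instead of an arbitrary number names the
    -- resident at once, as the point in row `b ℕ.* 2 ℕ.^ u ℕ.+ c`, and no inverse of the reversal
    -- is required.
    dyadic-tile : ∀ {b c} → b ℕ.< 2 ℕ.^ v → c ℕ.< 2 ℕ.^ u → Tile (dyadicBox v u (reverse u c) b)
    dyadic-tile {b} {c} b< c< = record
      { proper        = ℚₚ.<-trans (proj₁ in-columns) (proj₂ in-columns)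
      ; left-inside   = ℚₚ.≤-<-trans (ι-mono-≤ {0} ℕ.z≤n) (ι<κ (reverse u c ℕ.* 2 ℕ.^ v))
      ; right-inside  = ℚₚ.<-≤-trans (κ<ι (suc (reverse u c) ℕ.* 2 ℕ.^ v)) (ι-mono-≤ {_} {suc n} (ℕ.s≤s right≤n))
      ; left-generic  = λ i eq → κ≢ι _ (suc (column (toℕ i))) (sym eq)
      ; right-generic = λ i eq → κ≢ι _ (suc (column (toℕ i))) (sym eq)
      ; resident      = fromℕ< row<n
      ; resides       = subst (λ m → κ _ < ι (suc m) × ι (suc m) < κ _)
                          (trans (sym (resident-column b< c<)) (cong column (sym (Finₚ.toℕ-fromℕ< row<n)))) in-columns
                      , subst (λ m → κ _ < ι (suc m) × ι (suc m) < κ _)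
                          (sym (Finₚ.toℕ-fromℕ< row<n)) (κ-cell b c<)
      }
      where
      row<n = ℕₚ.<-≤-trans (row-< b< c<) 2^k≤n
      in-columns = κ-cell (reverse u c) (reverse-< v b)
      right≤n : suc (reverse u c) ℕ.* 2 ℕ.^ v ℕ.≤ n
      right≤n = ℕₚ.≤-trans (ℕₚ.*-monoˡ-≤ (2 ℕ.^ v) (reverse-< u c))
        (ℕₚ.≤-trans (ℕₚ.≤-reflexive (trans (sym (ℕₚ.^-distribˡ-+-* 2 u v)) (cong (2 ℕ.^_) u+v≡k))) 2^k≤n)

  -- A shape and a position. A shape whose halves are 2 ^ w wide and 2 ^ (k - w) high, with w from 1
  -- to k, has 2 ^ (k - w) columns of blocks with 2 ^ (w - 1) blocks each, so 2 ^ (k - 1) blocks for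
  -- every shape.
  Block : Set
  Block = Fin k × Fin (2 ℕ.^ (k ℕ.∸ 1))

  module _ (d : Block) where

    -- `width` and `height` are exponents and belong to a half, the block itself being twice as
    -- high. The column of the block is the reversal of `offset`; `stack` counts whole blocks from
    -- below.
    width height offset stack : ℕ
    width  = suc (toℕ (proj₁ d))
    height = k ℕ.∸ width
    offset = (toℕ (proj₂ d) ℕ.% 2 ℕ.^ height) ⦃ ℕₚ.m^n≢0 2 height ⦄
    stack  = (toℕ (proj₂ d) ℕ./ 2 ℕ.^ height) ⦃ ℕₚ.m^n≢0 2 height ⦄

    offset-< : offset ℕ.< 2 ℕ.^ height
    offset-< = DivMod.m%n<n _ _ ⦃ ℕₚ.m^n≢0 2 height ⦄

    height+width : height ℕ.+ width ≡ k
    height+width = ℕₚ.m∸n+n≡m (Finₚ.toℕ<n (proj₁ d))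

    stack-< : stack ℕ.< 2 ℕ.^ toℕ (proj₁ d)
    stack-< = DivMod.m<n*o⇒m/o<n ⦃ ℕₚ.m^n≢0 2 height ⦄ (ℕₚ.<-≤-trans (Finₚ.toℕ<n (proj₂ d)) (ℕₚ.≤-reflexive
      (trans (cong (λ w → 2 ℕ.^ (w ℕ.∸ 1)) (trans (sym height+width) (ℕₚ.+-suc height _)))
        (trans (cong (2 ℕ.^_) (ℕₚ.+-comm height _)) (ℕₚ.^-distribˡ-+-* 2 (toℕ (proj₁ d)) height)))))

    half-row : End → ℕ
    half-row lower = 2 ℕ.* stack
    half-row upper = suc (2 ℕ.* stack)

    half-row-< : ∀ e → half-row e ℕ.< 2 ℕ.^ width
    half-row-< lower = ℕₚ.*-monoʳ-< 2 stack-<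
    half-row-< upper = ℕₚ.<-≤-trans (ℕ.s≤s ℕₚ.≤-refl)
      (ℕₚ.≤-trans (ℕₚ.≤-reflexive (cong suc (sym (ℕₚ.+-suc stack (stack ℕ.+ 0))))) (ℕₚ.*-monoʳ-≤ 2 stack-<))

    half : End → Box
    half e = dyadicBox width height (reverse height offset) (half-row e)

    half-tile : ∀ e → Tile (half e)
    half-tile e = dyadic-tile height+width (half-row-< e) offset-<

    half-bottom : ∀ e → stack ℕ.* 2 ℕ.^ suc height ℕ.≤ half-row e ℕ.* 2 ℕ.^ height
    half-bottom e = ℕₚ.≤-trans (ℕₚ.≤-reflexive (trans (sym (ℕₚ.*-assoc stack 2 (2 ℕ.^ height))) (cong (ℕ._* 2 ℕ.^ height) (ℕₚ.*-comm stack 2))))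
      (ℕₚ.*-monoˡ-≤ (2 ℕ.^ height) (above e))
      where
      above : ∀ e → 2 ℕ.* stack ℕ.≤ half-row e
      above lower = ℕₚ.≤-refl
      above upper = ℕₚ.n≤1+n _

    half-top : ∀ e → suc (half-row e) ℕ.* 2 ℕ.^ height ℕ.≤ suc stack ℕ.* 2 ℕ.^ suc height
    half-top e = ℕₚ.≤-trans (ℕₚ.*-monoˡ-≤ (2 ℕ.^ height) (below e))
      (ℕₚ.≤-reflexive (trans (cong (ℕ._* 2 ℕ.^ height) (ℕₚ.*-comm 2 (suc stack))) (ℕₚ.*-assoc (suc stack) 2 (2 ℕ.^ height))))
      where
      below : ∀ e → suc (half-row e) ℕ.≤ 2 ℕ.* suc stack
      below lower = ℕₚ.≤-trans (ℕₚ.n≤1+n _) (below upper)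
      below upper = ℕₚ.≤-reflexive (cong suc (sym (ℕₚ.+-suc stack (stack ℕ.+ 0))))

    rows-disjoint : ∀ {q} e → bottom (half e) < q × q < top (half e) →
      ¬ (bottom (half (other e)) < q × q < top (half (other e)))
    rows-disjoint lower (p , q) (p′ , q′) =
      ℕₚ.1+n≢n {2 ℕ.* stack} (dyadic-unique {a = suc (2 ℕ.* stack)} {2 ℕ.* stack} {2 ℕ.^ height} p′ q′ p q)
    rows-disjoint upper (p , q) (p′ , q′) =
      ℕₚ.1+n≢n {2 ℕ.* stack} (dyadic-unique {a = suc (2 ℕ.* stack)} {2 ℕ.* stack} {2 ℕ.^ height} p q p′ q′)

    in-stack : ∀ {c} e → c ∈ᴮ° half e →
      κ (stack ℕ.* 2 ℕ.^ suc height) < y c × y c < κ (suc stack ℕ.* 2 ℕ.^ suc height)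
    in-stack e (_ , p , q) = ℚₚ.≤-<-trans (κ-mono-≤ (half-bottom e)) p , ℚₚ.<-≤-trans q (κ-mono-≤ (half-top e))

  Converted : Rectangulation points (grid n) → Block → Set
  Converted r d = ∀ e → Crossed r (half d e)

  converted? : ∀ r d → Dec (Converted r d)
  converted? r d with crossed? r (half d lower) | crossed? r (half d upper)
  ... | yes p | yes q = yes λ { lower → p ; upper → q }
  ... | no ¬p | _     = no λ c → ¬p (c lower)
  ... | _     | no ¬q = no λ c → ¬q (c upper)

  -- Everything is said about the rectangulation before the operation, so that uniqueness becomes a
  -- statement about a single rectangulation and a point.
  New : Rectangulation points (grid n) → Point → Block → Set
  New r c d = ∃[ e ] (c ∈ᴮ° half d e × ¬ Crossed r (half d e) × Crossed r (half d (other e)))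

  -- The two halves share no height, so the pivot lies in at most one of them and the other one must
  -- have been crossed before.
  newly-converted : ∀ {r r′ c} → Pivot r r′ c → ∀ d → Converted r′ d → ¬ Converted r d → New r c d
  newly-converted {r} {r′} {c} piv d conv ¬conv
    with piv (half-tile d lower) (conv lower) | piv (half-tile d upper) (conv upper)
  ... | inj₁ p | inj₁ q = contradiction (λ { lower → p ; upper → q }) ¬conv
  ... | inj₂ p | inj₂ q = contradiction (proj₂ q) (rows-disjoint d lower (proj₂ p))
  ... | inj₂ p | inj₁ q = lower , p , (λ l → ¬conv λ { lower → l ; upper → q }) , q
  ... | inj₁ p | inj₂ q = upper , q , (λ u → ¬conv λ { lower → p ; upper → u }) , p

  -- A block on a higher level is wider and so low that it fits into the half of d which
  -- contains the pivot: a segment crossing it crosses that half.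
  no-two-levels : ∀ {r c} d d′ → width d ℕ.< width d′ → New r c d → ¬ New r c d′
  no-two-levels {r} {c} d d′ w<w′ (e , c∈ , ¬crossed , _) (e′ , c∈′ , _ , crossed) =
    ¬crossed (Crossed-mono r
      (κ-mono-≤ (proj₁ columns)) (κ-mono-≤ (proj₂ columns))
      (κ-mono-≤ (ℕₚ.≤-trans (proj₁ rows) (half-bottom d′ (other e′))))
      (κ-mono-≤ (ℕₚ.≤-trans (half-top d′ (other e′)) (proj₂ rows)))
      crossed)
    where
    split-width = 2^-split (ℕₚ.<⇒≤ w<w′)
    -- The successor matters: the whole block `d′`, not only one of its halves, is at most as high
    -- as a half of `d`. So the half `other e′`, which need not contain the pivot, is enclosed as
    -- well.
    h′<h : suc (height d′) ℕ.≤ height d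
    h′<h = ℕₚ.∸-monoʳ-< w<w′ (Finₚ.toℕ<n (proj₁ d′))
    split-height = 2^-split h′<h
    columns : reverse (height d′) (offset d′) ℕ.* 2 ℕ.^ width d′ ℕ.≤ reverse (height d) (offset d) ℕ.* 2 ℕ.^ width d
            × suc (reverse (height d) (offset d)) ℕ.* 2 ℕ.^ width d ℕ.≤ suc (reverse (height d′) (offset d′)) ℕ.* 2 ℕ.^ width d′
    columns = subst (λ s → reverse (height d′) (offset d′) ℕ.* s ℕ.≤ reverse (height d) (offset d) ℕ.* 2 ℕ.^ width d
            × suc (reverse (height d) (offset d)) ℕ.* 2 ℕ.^ width d ℕ.≤ suc (reverse (height d′) (offset d′)) ℕ.* s)
            (sym split-width)
            (dyadic-nested {a = reverse (height d) (offset d)} {a′ = reverse (height d′) (offset d′)} {w = 2 ℕ.^ (width d′ ℕ.∸ width d)}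
              (proj₁ (proj₁ c∈)) (proj₂ (proj₁ c∈))
              (subst (λ s → κ (reverse (height d′) (offset d′) ℕ.* s) < x c) split-width (proj₁ (proj₁ c∈′)))
              (subst (λ s → x c < κ (suc (reverse (height d′) (offset d′)) ℕ.* s)) split-width (proj₂ (proj₁ c∈′))))
    rows : half-row d e ℕ.* 2 ℕ.^ height d ℕ.≤ stack d′ ℕ.* 2 ℕ.^ suc (height d′)
         × suc (stack d′) ℕ.* 2 ℕ.^ suc (height d′) ℕ.≤ suc (half-row d e) ℕ.* 2 ℕ.^ height d
    rows = subst (λ s → half-row d e ℕ.* s ℕ.≤ stack d′ ℕ.* 2 ℕ.^ suc (height d′)
         × suc (stack d′) ℕ.* 2 ℕ.^ suc (height d′) ℕ.≤ suc (half-row d e) ℕ.* s)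
         (sym split-height)
         (dyadic-nested {a = stack d′} {a′ = half-row d e} {s = 2 ℕ.^ suc (height d′)} {w = 2 ℕ.^ (height d ℕ.∸ suc (height d′))}
           (proj₁ (in-stack d′ e′ c∈′)) (proj₂ (in-stack d′ e′ c∈′))
           (subst (λ s → κ (half-row d e ℕ.* s) < y c) split-height (proj₁ (proj₂ c∈)))
           (subst (λ s → y c < κ (suc (half-row d e) ℕ.* s)) split-height (proj₂ (proj₂ c∈))))

  same-level : ∀ {r c} i {m m′} → New r c (i , m) → New r c (i , m′) → m ≡ m′
  same-level {r} {c} i {m} {m′} (e , c∈ , _) (e′ , c∈′ , _) = Finₚ.toℕ-injective (begin
    toℕ m                                   ≡⟨ DivMod.m≡m%n+[m/n]*n (toℕ m) (2 ℕ.^ h) ⟩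
    offset d ℕ.+ stack d ℕ.* 2 ℕ.^ h        ≡⟨ cong₂ (λ p q → p ℕ.+ q ℕ.* 2 ℕ.^ h) offset≡ stack≡ ⟩
    offset d′ ℕ.+ stack d′ ℕ.* 2 ℕ.^ h      ≡⟨ DivMod.m≡m%n+[m/n]*n (toℕ m′) (2 ℕ.^ h) ⟨
    toℕ m′                                  ∎)
    where
    open ≡-Reasoning
    d  = i , m
    d′ = i , m′
    h  = height d
    instance _ = ℕₚ.m^n≢0 2 h
    offset≡ : offset d ≡ offset d′
    offset≡ = reverse-injective h (offset-< d) (offset-< d′)
      (dyadic-unique {s = 2 ℕ.^ width d} (proj₁ (proj₁ c∈)) (proj₂ (proj₁ c∈)) (proj₁ (proj₁ c∈′)) (proj₂ (proj₁ c∈′)))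
    -- The pivot may be in the lower half for one block and in the upper half for the other as far
    -- as is known, so whole blocks are compared.
    stack≡ : stack d ≡ stack d′
    stack≡ = dyadic-unique {s = 2 ℕ.^ suc h} (proj₁ (in-stack d e c∈)) (proj₂ (in-stack d e c∈))
      (proj₁ (in-stack d′ e′ c∈′)) (proj₂ (in-stack d′ e′ c∈′))

  new-unique : ∀ {r c} d d′ → New r c d → New r c d′ → d ≡ d′
  new-unique {r} {c} d@(i , m) d′@(i′ , m′) new new′ with ℕₚ.<-cmp (toℕ i) (toℕ i′)
  ... | tri< i<i′ _ _ = contradiction new′ (no-two-levels {r} {c} d d′ (ℕ.s≤s i<i′) new)
  ... | tri> _ _ i′<i = contradiction new (no-two-levels {r} {c} d′ d (ℕ.s≤s i′<i) new′)
  ... | tri≈ _ i≡i′ _ with Finₚ.toℕ-injective i≡i′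
  ...   | refl = cong (i ,_) (same-level {r} {c} i new new′)

  block : Fin (k ℕ.* 2 ℕ.^ (k ℕ.∸ 1)) → Block
  block = Fin.remQuot (2 ℕ.^ (k ℕ.∸ 1))

  block-injective : ∀ {i j} → block i ≡ block j → i ≡ j
  block-injective {i} {j} eq = trans (sym (Finₚ.combine-remQuot {k} _ i))
    (trans (cong (λ (p , q) → Fin.combine p q) eq) (Finₚ.combine-remQuot {k} _ j))

  -- Conversion may be undone along a walk, so `L` is only required to contain the blocks converted
  -- at present: it never shrinks and grows by at most one entry per operation. At the end it covers
  -- all blocks.
  walk-length : ∀ {r s m} → Walk r s m → (L : List (Fin (k ℕ.* 2 ℕ.^ (k ℕ.∸ 1)))) →
    (∀ i → Converted r (block i) → i ∈ L) → (∀ d → Converted s d) →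
    k ℕ.* 2 ℕ.^ (k ℕ.∸ 1) ℕ.≤ m ℕ.+ length L
  walk-length {r} (stay r≈s) L listed all = covering-list L (λ i → listed i
    (λ e → let (j , hor , p , q) = all (block i) e in j , subst
      (λ s → orient s ≡ horizontal × (lo s ≤ _ × _ ≤ hi s) × (_ < level s × level s < _)) (sym (r≈s j)) (hor , p , q)))
  walk-length {r} (step {s = r′} {k = m} adj w) L listed all with pivot adj
  ... | c , piv with Finₚ.any? (λ i → converted? r′ (block i) ×-dec ¬? (converted? r (block i)))
  ...   | no none = ℕₚ.≤-trans (walk-length w L kept all) (ℕₚ.n≤1+n _)
    where
    kept : ∀ i → Converted r′ (block i) → i ∈ L
    kept i conv with converted? r (block i)
    ... | yes p = listed i p
    ... | no ¬p = contradiction (i , conv , ¬p) none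
  ...   | yes (j , conv , ¬conv) = ℕₚ.≤-trans (walk-length w (j ∷ L) extended all) (ℕₚ.≤-reflexive (ℕₚ.+-suc m _))
    where
    extended : ∀ i → Converted r′ (block i) → i ∈ j ∷ L
    extended i conv′ with converted? r (block i)
    ... | yes p = there (listed i p)
    ... | no ¬p = here (block-injective (new-unique {r} {c} (block i) (block j)
                    (newly-converted {r} {r′} piv (block i) conv′ ¬p) (newly-converted {r} {r′} piv (block j) conv ¬conv)))

-- Boundaries of boxes, and the stages of the sweep as rectangulations.

<⇒≱ : ∀ {p q : ℚ} → p < q → ¬ (q ≤ p)
<⇒≱ p<q q≤p = ℚₚ.<-irrefl refl (ℚₚ.<-≤-trans p<q q≤p)

≤∧≢⇒< : ∀ {p q} → p ≤ q → p ≢ q → p < q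
≤∧≢⇒< {p} {q} p≤q p≢q with ℚₚ.<-cmp p q
... | tri< p<q _ _ = p<q
... | tri≈ _ p≡q _ = contradiction p≡q p≢q
... | tri> _ _ q<p = contradiction p≤q (<⇒≱ q<p)

∂-sides : ∀ {B q} → q ∈∂ B → x q ≡ left B ⊎ x q ≡ right B ⊎ y q ≡ bottom B ⊎ y q ≡ top B
∂-sides {B} {q} (((l≤ , ≤r) , b≤ , ≤t) , q∉°)
  with left B ℚₚ.≟ x q | x q ℚₚ.≟ right B | bottom B ℚₚ.≟ y q | y q ℚₚ.≟ top B
... | yes e | _     | _     | _     = inj₁ (sym e)
... | no _  | yes e | _     | _     = inj₂ (inj₁ e)
... | no _  | no _  | yes e | _     = inj₂ (inj₂ (inj₁ (sym e)))
... | no _  | no _  | no _  | yes e = inj₂ (inj₂ (inj₂ e))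
... | no ≢l | no ≢r | no ≢b | no ≢t =
  contradiction ((≤∧≢⇒< l≤ ≢l , ≤∧≢⇒< ≤r ≢r) , ≤∧≢⇒< b≤ ≢b , ≤∧≢⇒< ≤t ≢t) q∉°

sides-∂ : ∀ {B q} → q ∈ᴮ B → x q ≡ left B ⊎ x q ≡ right B ⊎ y q ≡ bottom B ⊎ y q ≡ top B → q ∈∂ B
sides-∂ q∈ (inj₁ e)               = q∈ , λ ((p , _) , _) → ℚₚ.<-irrefl (sym e) p
sides-∂ q∈ (inj₂ (inj₁ e))        = q∈ , λ ((_ , p) , _) → ℚₚ.<-irrefl e p
sides-∂ q∈ (inj₂ (inj₂ (inj₁ e))) = q∈ , λ (_ , p , _) → ℚₚ.<-irrefl (sym e) p
sides-∂ q∈ (inj₂ (inj₂ (inj₂ e))) = q∈ , λ (_ , _ , p) → ℚₚ.<-irrefl e p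

ι-floor : ∀ m {q} → ι 0 ≤ q → q < ι m → ∃[ p ] (p ℕ.< m × ι p ≤ q × q < ι (suc p))
ι-floor zero    0≤q q<0 = contradiction 0≤q (<⇒≱ q<0)
ι-floor (suc m) {q} 0≤q q<m with q ℚₚ.<? ι m
... | no q≮m  = m , ℕₚ.≤-refl , ℚₚ.≮⇒≥ q≮m , q<m
... | yes q<m = let (p , p<m , r) = ι-floor m 0≤q q<m in p , ℕₚ.m<n⇒m<1+n p<m , r

no-ι-between : ∀ {m p} {q : ℚ} → ι m < q → q < ι (suc m) → q ≢ ι p
no-ι-between m<q q<m refl = ℕₚ.<⇒≱ (ι-cancel-< m<q) (ℕₚ.≤-pred (ι-cancel-< q<m))

module Sweep (n : ℕ) (column : Fin n → ℕ) (column-< : ∀ i → column i ℕ.< n)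
             (column-injective : ∀ {i j} → column i ≡ column j → i ≡ j) where

  X Y : Fin n → ℕ
  X i = suc (column i)
  Y i = suc (toℕ i)

  X<1+n : ∀ i → X i ℕ.< suc n
  X<1+n i = ℕ.s≤s (column-< i)

  Y<1+n : ∀ i → Y i ℕ.< suc n
  Y<1+n i = ℕ.s≤s (Finₚ.toℕ<n i)

  X-injective : ∀ {i j} → ι (X i) ≡ ι (X j) → i ≡ j
  X-injective eq = column-injective (ℕₚ.suc-injective (ι-injective eq))

  Y-injective : ∀ {i j} → ι (Y i) ≡ ι (Y j) → i ≡ j
  Y-injective eq = Finₚ.toℕ-injective (ℕₚ.suc-injective (ι-injective eq))

  points : PointSet n
  points i = pt (ι (X i)) (ι (Y i))

  -- At a stage with current row `c` the vertical segments stand exactly at these abscissas.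
  Wall : Fin n → ℕ → Set
  Wall c m = ∃[ j ] (toℕ c ℕ.< toℕ j × X j ≡ m)

  wall? : ∀ c m → Dec (Wall c m)
  wall? c m = Finₚ.any? λ j → (toℕ c ℕ.<? toℕ j) ×-dec (X j ℕ.≟ m)

  wall-above : ∀ c d p → p ℕ.+ suc d ≡ suc n →
    ∃[ v ] (p ℕ.< v × (v ≡ suc n ⊎ Wall c v) × (∀ w → Wall c w → p ℕ.< w → v ℕ.≤ w))
  wall-above c d p eq with wall? c (suc p)
  ... | yes wall = suc p , ℕₚ.≤-refl , inj₂ wall , λ _ _ p<w → p<w
  wall-above c zero p eq | no _ =
    suc p , ℕₚ.≤-refl , inj₁ (trans (ℕₚ.+-comm 1 p) eq) , λ _ _ p<w → p<w
  wall-above c (suc d) p eq | no ¬wall with wall-above c d (suc p) (trans (sym (ℕₚ.+-suc p (suc d))) eq)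
  ... | v , p<v , stop , least = v , ℕₚ.<-trans (ℕₚ.n<1+n p) p<v , stop ,
    λ w wall p<w → least w wall (ℕₚ.≤∧≢⇒< p<w λ { refl → ¬wall wall })

  next-stop : ∀ c p → p ℕ.< suc n →
    ∃[ v ] (p ℕ.< v × (v ≡ suc n ⊎ Wall c v) × (∀ w → Wall c w → p ℕ.< w → v ℕ.≤ w))
  next-stop c p (ℕ.s≤s p≤n) = wall-above c (n ℕ.∸ p) p (trans (ℕₚ.+-suc p _) (cong suc (ℕₚ.m+[n∸m]≡n p≤n)))

  -- Not strict in `p`, unlike `next-stop`, to fit the half-open cells given by `ι-floor`. A strict
  -- search to the left of the point `i` therefore starts at `column i`, one less than `X i`.
  previous-stop : ∀ c p →
    ∃[ u ] (u ℕ.≤ p × (u ≡ 0 ⊎ Wall c u) × (∀ w → Wall c w → w ℕ.≤ p → w ℕ.≤ u))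
  previous-stop c zero = 0 , ℕₚ.≤-refl , inj₁ refl , λ _ _ w≤0 → w≤0
  previous-stop c (suc p) with wall? c (suc p)
  ... | yes wall = suc p , ℕₚ.≤-refl , inj₂ wall , λ _ _ w≤p → w≤p
  ... | no ¬wall with previous-stop c p
  ...   | u , u≤p , stop , most = u , ℕₚ.m≤n⇒m≤1+n u≤p , stop ,
    λ w wall w≤1+p → most w wall (ℕₚ.≤-pred (ℕₚ.≤∧≢⇒< w≤1+p λ { refl → ¬wall wall }))

  fullˢ : Fin n → Segment
  fullˢ k = segment horizontal (ι (Y k)) (ι 0) (ι (suc n))

  wallˢ : Fin n → ℕ → Segment
  wallˢ k b = segment vertical (ι (X k)) (ι b) (ι (suc n))

  -- A stage of the sweep: the segments below the current point are horizontal
  -- and span the grid, the current one spans l to h, and those above it are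
  -- vertical, resting on the current one or else on the one below it.
  record Stage : Set where
    field
      cur    : Fin n
      l h    : ℕ
      l<X    : l ℕ.< X cur
      X<h    : X cur ℕ.< h
      l-stop : l ≡ 0 ⊎ Wall cur l
      h-stop : h ≡ suc n ⊎ Wall cur h

    inner? : ∀ k → Dec (l ℕ.< X k × X k ℕ.< h)
    inner? k = (l ℕ.<? X k) ×-dec (X k ℕ.<? h)

    stageSeg : Fin n → Segment
    stageSeg k with ℕₚ.<-cmp (toℕ k) (toℕ cur)
    ... | tri< _ _ _ = fullˢ k
    ... | tri≈ _ _ _ = segment horizontal (ι (Y cur)) (ι l) (ι h)
    ... | tri> _ _ _ with inner? k
    ...   | yes _ = wallˢ k (Y cur)
    -- As `Y i` is `suc (toℕ i)`, the grid line `toℕ cur` is the level of the row below the current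
    -- one, or the bottom of the square if there is no such row.
    ...   | no  _ = wallˢ k (toℕ cur)

    data View (k : Fin n) : Segment → Set where
      full    : toℕ k ℕ.< toℕ cur → View k (fullˢ k)
      current : k ≡ cur → View k (segment horizontal (ι (Y cur)) (ι l) (ι h))
      inner   : toℕ cur ℕ.< toℕ k → l ℕ.< X k × X k ℕ.< h → View k (wallˢ k (Y cur))
      outer   : toℕ cur ℕ.< toℕ k → ¬ (l ℕ.< X k × X k ℕ.< h) → View k (wallˢ k (toℕ cur))

    view : ∀ k → View k (stageSeg k)
    view k with ℕₚ.<-cmp (toℕ k) (toℕ cur)
    ... | tri< k<c _ _ = full k<c
    ... | tri≈ _ k≡c _ = current (Finₚ.toℕ-injective k≡c)
    ... | tri> _ _ c<k with inner? k
    ...   | yes in-lh = inner c<k in-lh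
    ...   | no out-lh = outer c<k out-lh

    view-unique : ∀ {k s s′} → View k s → View k s′ → s ≡ s′
    view-unique (full _)       (full _)       = refl
    view-unique (full k<c)     (current refl) = contradiction k<c (ℕₚ.<-irrefl refl)
    view-unique (full k<c)     (inner c<k _)  = contradiction k<c (ℕₚ.<-asym c<k)
    view-unique (full k<c)     (outer c<k _)  = contradiction k<c (ℕₚ.<-asym c<k)
    view-unique (current refl) (full k<c)     = contradiction k<c (ℕₚ.<-irrefl refl)
    view-unique (current _)    (current _)    = refl
    view-unique (current refl) (inner c<k _)  = contradiction c<k (ℕₚ.<-irrefl refl)
    view-unique (current refl) (outer c<k _)  = contradiction c<k (ℕₚ.<-irrefl refl)
    view-unique (inner c<k _)  (full k<c)     = contradiction k<c (ℕₚ.<-asym c<k)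
    view-unique (inner c<k _)  (current refl) = contradiction c<k (ℕₚ.<-irrefl refl)
    view-unique (inner _ _)    (inner _ _)    = refl
    view-unique (inner _ p)    (outer _ ¬p)   = contradiction p ¬p
    view-unique (outer c<k _)  (full k<c)     = contradiction k<c (ℕₚ.<-asym c<k)
    view-unique (outer c<k _)  (current refl) = contradiction c<k (ℕₚ.<-irrefl refl)
    view-unique (outer _ ¬p)   (inner _ p)    = contradiction p ¬p
    view-unique (outer _ _)    (outer _ _)    = refl

    seg-is : ∀ {k s} → View k s → stageSeg k ≡ s
    seg-is = view-unique (view _)

    -- A weakened form of membership, made for refutations: both kinds of vertical segments become
    -- one case that records how far down they reach.
    data On (q : Point) (k : Fin n) : Set where
      full    : toℕ k ℕ.< toℕ cur → y q ≡ ι (Y k) → On q k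
      current : k ≡ cur → y q ≡ ι (Y cur) → ι l ≤ x q → x q ≤ ι h → On q k
      upright : toℕ cur ℕ.< toℕ k → x q ≡ ι (X k) → ι (toℕ cur) ≤ y q →
                (l ℕ.< X k → X k ℕ.< h → ι (Y cur) ≤ y q) → On q k

    on : ∀ {q} k → q ∈ˢ stageSeg k → On q k
    on k q∈ with stageSeg k | view k
    on k (e , _)     | _ | full k<c          = full k<c e
    on k (e , p , q) | _ | current k≡c       = current k≡c e p q
    on k (e , p , _) | _ | inner c<k _       = upright c<k e (ℚₚ.≤-trans (ι-mono-≤ (ℕₚ.n≤1+n _)) p) (λ _ _ → p)
    on k (e , p , _) | _ | outer c<k ¬inner  = upright c<k e p (λ a b → contradiction (a , b) ¬inner)

    stop≤1+n : ∀ {v} → v ≡ suc n ⊎ Wall cur v → v ℕ.≤ suc n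
    stop≤1+n (inj₁ v≡)             = ℕₚ.≤-reflexive v≡
    stop≤1+n (inj₂ (j , _ , Xj≡v)) = ℕₚ.<⇒≤ (subst (ℕ._< suc n) Xj≡v (X<1+n j))

    h≤1+n : h ℕ.≤ suc n
    h≤1+n = stop≤1+n h-stop

    on-full : ∀ {q k} → toℕ k ℕ.< toℕ cur → q ∈ᴮ grid n → y q ≡ ι (Y k) → q ∈ˢ stageSeg k
    on-full k<c (q∈ , _) e rewrite seg-is (full k<c) = e , q∈

    on-current : ∀ {q} → y q ≡ ι (Y cur) → ι l ≤ x q → x q ≤ ι h → q ∈ˢ stageSeg cur
    on-current e p q rewrite seg-is (current refl) = e , p , q

    on-wall : ∀ {q k} → toℕ cur ℕ.< toℕ k → q ∈ᴮ grid n → x q ≡ ι (X k) → ι (Y cur) ≤ y q → q ∈ˢ stageSeg k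
    on-wall {q} {k} c<k (_ , _ , q≤) e p with stageSeg k | view k
    ... | _ | full k<c     = contradiction k<c (ℕₚ.<-asym c<k)
    ... | _ | current refl = contradiction c<k (ℕₚ.<-irrefl refl)
    ... | _ | inner _ _    = e , p , q≤
    ... | _ | outer _ _    = e , ℚₚ.≤-trans (ι-mono-≤ (ℕₚ.n≤1+n _)) p , q≤

    on-outer : ∀ {q k} → toℕ cur ℕ.< toℕ k → ¬ (l ℕ.< X k × X k ℕ.< h) →
      q ∈ᴮ grid n → x q ≡ ι (X k) → ι (toℕ cur) ≤ y q → q ∈ˢ stageSeg k
    on-outer c<k ¬inner (_ , _ , q≤) e p rewrite seg-is (outer c<k ¬inner) = e , p , q≤

    below-full : ∀ {q m} → m ℕ.≤ toℕ cur → q ∈ᴮ grid n → y q ≡ ι m → q ∈∂ grid n ⊎ ∃[ i ] q ∈ˢ stageSeg i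
    below-full {m = zero}  _   q∈ e = inj₁ (sides-∂ q∈ (inj₂ (inj₂ (inj₁ e))))
    below-full {q} {suc m} m<c q∈ e = inj₂ (fromℕ< m<n ,
      on-full (subst (ℕ._< toℕ cur) (sym eq) m<c) q∈ (trans e (cong (ι ∘ suc) (sym eq))))
      where
      m<n = ℕₚ.<-trans m<c (Finₚ.toℕ<n cur)
      eq : toℕ (fromℕ< m<n) ≡ m
      eq = Finₚ.toℕ-fromℕ< m<n

    0≤ι : ∀ {m} → ι 0 ≤ ι m
    0≤ι = ι-mono-≤ ℕ.z≤n

    ι≤1+n : ∀ {m} → m ℕ.≤ suc n → ι m ≤ ι (suc n)
    ι≤1+n = ι-mono-≤

    wall-within : ∀ {q} k {b} → q ∈ˢ wallˢ k b → q ∈ᴮ grid n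
    wall-within k (e , p , q) = (subst (ι 0 ≤_) (sym e) 0≤ι , subst (_≤ ι (suc n)) (sym e) (ι≤1+n (ℕₚ.<⇒≤ (X<1+n k))))
                              , ℚₚ.≤-trans 0≤ι p , q

    level-within : ∀ {q} k → ι 0 ≤ x q → x q ≤ ι (suc n) → y q ≡ ι (Y k) → q ∈ᴮ grid n
    level-within k p q e = (p , q)
                         , subst (ι 0 ≤_) (sym e) 0≤ι , subst (_≤ ι (suc n)) (sym e) (ι≤1+n (ℕₚ.<⇒≤ (Y<1+n k)))

    stage-within : ∀ k q → q ∈ˢ stageSeg k → q ∈ᴮ grid n
    stage-within k q q∈ with stageSeg k | view k
    stage-within k q (e , p , p′) | _ | full _    = level-within k p p′ e
    stage-within k q (e , p , p′) | _ | current _ =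
      level-within cur (ℚₚ.≤-trans 0≤ι p) (ℚₚ.≤-trans p′ (ι≤1+n h≤1+n)) e
    stage-within k q q∈           | _ | inner _ _ = wall-within k q∈
    stage-within k q q∈           | _ | outer _ _ = wall-within k q∈

    stage-through : ∀ k → points k ∈ˢ° stageSeg k
    stage-through k with stageSeg k | view k
    ... | _ | full _       = refl , ι-mono-< (ℕ.s≤s ℕ.z≤n) , ι-mono-< (X<1+n k)
    ... | _ | current refl = refl , ι-mono-< l<X , ι-mono-< X<h
    ... | _ | inner c<k _  = refl , ι-mono-< (ℕ.s≤s c<k) , ι-mono-< (Y<1+n k)
    ... | _ | outer c<k _  = refl , ι-mono-< (ℕₚ.m<n⇒m<1+n c<k) , ι-mono-< (Y<1+n k)

    stage-only : ∀ i j → points j ∈ˢ stageSeg i → j ≡ i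
    stage-only i j Pj∈ with on i Pj∈
    ... | full _ e           = Y-injective e
    ... | current refl e _ _ = Y-injective e
    ... | upright _ e _ _     = X-injective e

    level-wall : ∀ {q} i j → orient (stageSeg i) ≡ horizontal → orient (stageSeg j) ≡ vertical →
      ¬ (q ∈ˢ° stageSeg i × q ∈ˢ° stageSeg j)
    level-wall i j hor ver q∈ with stageSeg i | view i | stageSeg j | view j
    level-wall i j () _ _ | _ | inner _ _ | _ | _
    level-wall i j () _ _ | _ | outer _ _ | _ | _
    level-wall i j _ () _ | _ | full _    | _ | full _
    level-wall i j _ () _ | _ | full _    | _ | current _
    level-wall i j _ () _ | _ | current _ | _ | full _
    level-wall i j _ () _ | _ | current _ | _ | current _
    level-wall i j _ _ ((e , _) , _ , b<q , _) | _ | full i<c | _ | inner _ _ =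
      <⇒≱ b<q (ℚₚ.≤-trans (ℚₚ.≤-reflexive e) (ι-mono-≤ (ℕₚ.m≤n⇒m≤1+n i<c)))
    level-wall i j _ _ ((e , _) , _ , b<q , _) | _ | full i<c | _ | outer _ _ =
      <⇒≱ b<q (ℚₚ.≤-trans (ℚₚ.≤-reflexive e) (ι-mono-≤ i<c))
    level-wall i j _ _ ((e , _) , _ , b<q , _) | _ | current _ | _ | inner _ _ =
      <⇒≱ b<q (ℚₚ.≤-reflexive e)
    level-wall i j _ _ ((_ , l<q , q<h) , e , _) | _ | current _ | _ | outer _ ¬inner =
      ¬inner (ι-cancel-< (subst (ι l <_) e l<q) , ι-cancel-< (subst (_< ι h) e q<h))

    level-is : ∀ {q} k → orient (stageSeg k) ≡ horizontal → q ∈ˢ° stageSeg k → y q ≡ ι (Y k)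
    level-is k hor q∈ with stageSeg k | view k
    level-is k _ (e , _) | _ | full _       = e
    level-is k _ (e , _) | _ | current refl = e

    wall-is : ∀ {q} k → orient (stageSeg k) ≡ vertical → q ∈ˢ° stageSeg k → x q ≡ ι (X k)
    wall-is k ver q∈ with stageSeg k | view k
    wall-is k _ (e , _) | _ | inner _ _ = e
    wall-is k _ (e , _) | _ | outer _ _ = e

    stage-noncrossing : ∀ i j → i ≢ j → ∀ q → ¬ (q ∈ˢ° stageSeg i × q ∈ˢ° stageSeg j)
    stage-noncrossing i j i≢j q (q∈i , q∈j) = by-orientation _ _ refl refl
      where
      by-orientation : ∀ o o′ → orient (stageSeg i) ≡ o → orient (stageSeg j) ≡ o′ → _
      by-orientation horizontal vertical   oᵢ oⱼ = level-wall i j oᵢ oⱼ (q∈i , q∈j)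
      by-orientation vertical   horizontal oᵢ oⱼ = level-wall j i oⱼ oᵢ (q∈j , q∈i)
      by-orientation horizontal horizontal oᵢ oⱼ =
        i≢j (Y-injective (trans (sym (level-is i oᵢ q∈i)) (level-is j oⱼ q∈j)))
      by-orientation vertical   vertical   oᵢ oⱼ =
        i≢j (X-injective (trans (sym (wall-is i oᵢ q∈i)) (wall-is j oⱼ q∈j)))

    Anchored : Point → Orientation → Set
    Anchored q o = q ∈∂ grid n ⊎ ∃[ j ] (orient (stageSeg j) ≢ o × q ∈ˢ° stageSeg j)

    -- A wall at an end of the current segment is not inner, so it goes on down to the row below and
    -- has that end in its relative interior.
    at-wall : ∀ {m} → Wall cur m → ¬ (l ℕ.< m × m ℕ.< h) → Anchored (pt (ι m) (ι (Y cur))) horizontal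
    at-wall (j , c<j , refl) ¬inner = inj₂ (j , meets)
      where
      meets : orient (stageSeg j) ≢ horizontal × pt (ι (X j)) (ι (Y cur)) ∈ˢ° stageSeg j
      meets rewrite seg-is (outer c<j ¬inner) = (λ ()) , refl , ι-mono-< ℕₚ.≤-refl , ι-mono-< (Y<1+n cur)

    Y-within : ∀ k → ι 0 ≤ ι (Y k) × ι (Y k) ≤ ι (suc n)
    Y-within k = 0≤ι , ι≤1+n (ℕₚ.<⇒≤ (Y<1+n k))

    X-within : ∀ k → ι 0 ≤ ι (X k) × ι (X k) ≤ ι (suc n)
    X-within k = 0≤ι , ι≤1+n (ℕₚ.<⇒≤ (X<1+n k))

    bottom-anchored : ∀ k m → m ℕ.≤ toℕ cur → Anchored (pt (ι (X k)) (ι m)) vertical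
    bottom-anchored k zero    _   = inj₁ (sides-∂ (X-within k , ℚₚ.≤-refl , 0≤ι) (inj₂ (inj₂ (inj₁ refl))))
    bottom-anchored k (suc m) m<c = inj₂ (below , meets)
      where
      m<n = ℕₚ.<-trans m<c (Finₚ.toℕ<n cur)
      below = fromℕ< m<n
      below≡ : toℕ below ≡ m
      below≡ = Finₚ.toℕ-fromℕ< m<n
      meets : orient (stageSeg below) ≢ vertical × pt (ι (X k)) (ι (suc m)) ∈ˢ° stageSeg below
      meets rewrite seg-is {below} (full (subst (ℕ._< toℕ cur) (sym below≡) m<c)) =
        (λ ()) , cong (ι ∘ suc) (sym below≡) , ι-mono-< (ℕ.s≤s ℕ.z≤n) , ι-mono-< (X<1+n k)

    stage-anchored : ∀ i e → Anchored (endpoint (stageSeg i) e) (orient (stageSeg i))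
    stage-anchored i e with stageSeg i | view i
    stage-anchored i lower | _ | full _    = inj₁ (sides-∂ ((ℚₚ.≤-refl , 0≤ι) , Y-within i) (inj₁ refl))
    stage-anchored i upper | _ | full _    = inj₁ (sides-∂ ((0≤ι , ℚₚ.≤-refl) , Y-within i) (inj₂ (inj₁ refl)))
    stage-anchored i lower | _ | current _ with l-stop
    ... | inj₁ l≡0 = inj₁ (sides-∂ ((0≤ι , ι≤1+n (ℕₚ.<⇒≤ (ℕₚ.<-trans l<X (X<1+n cur)))) , Y-within cur) (inj₁ (cong ι l≡0)))
    ... | inj₂ wall = at-wall wall (λ (l<l , _) → ℕₚ.<-irrefl refl l<l)
    stage-anchored i upper | _ | current _ with h-stop
    ... | inj₁ h≡ = inj₁ (sides-∂ ((0≤ι , ι≤1+n h≤1+n) , Y-within cur) (inj₂ (inj₁ (cong ι h≡))))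
    ... | inj₂ wall = at-wall wall (λ (_ , h<h) → ℕₚ.<-irrefl refl h<h)
    stage-anchored i lower | _ | inner _ (l<Xi , Xi<h) = inj₂ (cur , meets)
      where
      meets : orient (stageSeg cur) ≢ vertical × pt (ι (X i)) (ι (Y cur)) ∈ˢ° stageSeg cur
      meets rewrite seg-is (current refl) = (λ ()) , refl , ι-mono-< l<Xi , ι-mono-< Xi<h
    stage-anchored i upper | _ | inner _ _ = inj₁ (sides-∂ (X-within i , 0≤ι , ℚₚ.≤-refl) (inj₂ (inj₂ (inj₂ refl))))
    stage-anchored i lower | _ | outer _ _ = bottom-anchored i (toℕ cur) ℕₚ.≤-refl
    stage-anchored i upper | _ | outer _ _ = inj₁ (sides-∂ (X-within i , 0≤ι , ℚₚ.≤-refl) (inj₂ (inj₂ (inj₂ refl))))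

    -- There are strips under full rows, the pocket under the current segment, and columns between
    -- neighbouring walls. Floors place `q` only in half-open ranges; the lower bounds become strict
    -- because `q` lies on no segment and not on the frame.
    module FaceAt (q : Point) (q∈ : q ∈ᴮ° grid n) (q∉ : ∀ i → ¬ (q ∈ˢ stageSeg i)) where

      Face : Set
      Face = ∃[ F ] (q ∈ᴮ° F × IsFace (grid n) stageSeg F)

      q∈ᴮ : q ∈ᴮ grid n
      q∈ᴮ = let ((a , b) , (c , d)) = q∈ in (ℚₚ.<⇒≤ a , ℚₚ.<⇒≤ b) , ℚₚ.<⇒≤ c , ℚₚ.<⇒≤ d

      off-row : ∀ {m} → m ℕ.≤ toℕ cur → y q ≢ ι m
      off-row m≤c e with below-full m≤c q∈ᴮ e
      ... | inj₁ (_ , q∉°)  = q∉° q∈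
      ... | inj₂ (i , q∈i) = q∉ i q∈i

      off-left : ∀ {b} → b ≡ 0 → x q ≢ ι b
      off-left refl e = ℚₚ.<-irrefl (sym e) (proj₁ (proj₁ q∈))

      strip : ∀ m → m ℕ.< toℕ cur → ι m ≤ y q → y q < ι (suc m) → Face
      strip m m<c m≤q q<m = F , (proj₁ q∈ , ≤∧≢⇒< m≤q (off-row (ℕₚ.<⇒≤ m<c) ∘ sym) , q<m) , record
        { inside = λ _ (p , b , t) → p , ℚₚ.≤-trans 0≤ι b , ℚₚ.≤-trans t (ι≤1+n 1+m≤1+n)
        ; empty  = λ z z∈ k z∈k → empty-strip z z∈ k (on k z∈k)
        ; framed = framed-strip
        }
        where
        F = box (ι 0) (ι (suc n)) (ι m) (ι (suc m))
        1+m≤1+n : suc m ℕ.≤ suc n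
        1+m≤1+n = ℕₚ.≤-trans m<c (ℕₚ.<⇒≤ (ℕₚ.<-trans (Finₚ.toℕ<n cur) ℕₚ.≤-refl))
        empty-strip : ∀ z → z ∈ᴮ° F → ∀ k → ¬ On z k
        empty-strip z (_ , b , t) k (full _ e)        = no-ι-between b t e
        empty-strip z (_ , b , t) k (current _ e _ _) = no-ι-between b t e
        empty-strip z (_ , b , t) k (upright _ _ p _)    = <⇒≱ t (ℚₚ.≤-trans (ι-mono-≤ m<c) p)
        framed-strip : ∀ z → z ∈∂ F → z ∈∂ grid n ⊎ ∃[ i ] z ∈ˢ stageSeg i
        framed-strip z z∈∂@((p , b , t) , _) with ∂-sides z∈∂
        ... | inj₁ e               = inj₁ (sides-∂ (p , ℚₚ.≤-trans 0≤ι b , ℚₚ.≤-trans t (ι≤1+n 1+m≤1+n)) (inj₁ e))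
        ... | inj₂ (inj₁ e)        = inj₁ (sides-∂ (p , ℚₚ.≤-trans 0≤ι b , ℚₚ.≤-trans t (ι≤1+n 1+m≤1+n)) (inj₂ (inj₁ e)))
        ... | inj₂ (inj₂ (inj₁ e)) = below-full (ℕₚ.<⇒≤ m<c) (p , ℚₚ.≤-trans 0≤ι b , ℚₚ.≤-trans t (ι≤1+n 1+m≤1+n)) e
        ... | inj₂ (inj₂ (inj₂ e)) = below-full m<c (p , ℚₚ.≤-trans 0≤ι b , ℚₚ.≤-trans t (ι≤1+n 1+m≤1+n)) e

      -- The face between the current segment and the one below it.
      pocket : ι l ≤ x q → x q < ι h → ι (toℕ cur) ≤ y q → y q < ι (Y cur) → Face
      pocket l≤q q<h c≤q q<c = F , ((≤∧≢⇒< l≤q (off-l l-stop ∘ sym) , q<h) , ≤∧≢⇒< c≤q (off-row ℕₚ.≤-refl ∘ sym) , q<c) , record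
        { inside = λ z → inside-pocket
        ; empty  = λ z z∈ k z∈k → empty-pocket z z∈ k (on k z∈k)
        ; framed = framed-pocket
        }
        where
        F = box (ι l) (ι h) (ι (toℕ cur)) (ι (Y cur))
        inside-pocket : ∀ {z} → z ∈ᴮ F → z ∈ᴮ grid n
        inside-pocket ((a , b) , c , d) = (ℚₚ.≤-trans 0≤ι a , ℚₚ.≤-trans b (ι≤1+n h≤1+n))
                                        , ℚₚ.≤-trans 0≤ι c , ℚₚ.≤-trans d (proj₂ (Y-within cur))
        off-l : l ≡ 0 ⊎ Wall cur l → x q ≢ ι l
        off-l (inj₁ l≡0)            e = off-left l≡0 e
        off-l (inj₂ (j , c<j , eq)) e = q∉ j (on-outer c<j (λ (l<Xj , _) → ℕₚ.<-irrefl (sym eq) l<Xj)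
          q∈ᴮ (trans e (cong ι (sym eq))) c≤q)
        empty-pocket : ∀ z → z ∈ᴮ° F → ∀ k → ¬ On z k
        empty-pocket z (_ , b , t) k (full k<c e)      = <⇒≱ b (ℚₚ.≤-trans (ℚₚ.≤-reflexive e) (ι-mono-≤ k<c))
        empty-pocket z (_ , b , t) k (current _ e _ _) = ℚₚ.<-irrefl e t
        empty-pocket z ((a , b) , _ , t) k (upright _ e _ p) =
          <⇒≱ t (p (ι-cancel-< (subst (ι l <_) e a)) (ι-cancel-< (subst (_< ι h) e b)))
        framed-pocket : ∀ z → z ∈∂ F → z ∈∂ grid n ⊎ ∃[ i ] z ∈ˢ stageSeg i
        framed-pocket z z∈∂@(z∈F@((a , b) , c , d) , _) with ∂-sides z∈∂ | l-stop | h-stop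
        ... | inj₁ e | inj₁ l≡0 | _ = inj₁ (sides-∂ (inside-pocket z∈F) (inj₁ (trans e (cong ι l≡0))))
        ... | inj₁ e | inj₂ (j , c<j , eq) | _ = inj₂ (j , on-outer c<j (λ (l<Xj , _) → ℕₚ.<-irrefl (sym eq) l<Xj)
                (inside-pocket z∈F) (trans e (cong ι (sym eq))) c)
        ... | inj₂ (inj₁ e) | _ | inj₁ h≡ = inj₁ (sides-∂ (inside-pocket z∈F) (inj₂ (inj₁ (trans e (cong ι h≡)))))
        ... | inj₂ (inj₁ e) | _ | inj₂ (j , c<j , eq) = inj₂ (j , on-outer c<j (λ (_ , Xj<h) → ℕₚ.<-irrefl eq Xj<h)
                (inside-pocket z∈F) (trans e (cong ι (sym eq))) c)
        ... | inj₂ (inj₂ (inj₁ e)) | _ | _ = below-full ℕₚ.≤-refl (inside-pocket z∈F) e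
        ... | inj₂ (inj₂ (inj₂ e)) | _ | _ = inj₂ (cur , on-current e a b)

      -- The faces between neighbouring vertical segments reach from the
      -- current segment or the one below it, at height b, up to the frame.
      module Column {u v} (u-stop : u ≡ 0 ⊎ Wall cur u) (v-stop : v ≡ suc n ⊎ Wall cur v)
                    (u≤q : ι u ≤ x q) (q<v : x q < ι v)
                    (no-wall : ∀ w → Wall cur w → u ℕ.< w → v ℕ.≤ w) where

        v≤1+n : v ℕ.≤ suc n
        v≤1+n = stop≤1+n v-stop

        -- The common part of both kinds of columns, with the floor at height `b`. The hypotheses
        -- say that the floor is solid, that the bounding walls reach down to it, and that the
        -- current segment does not pass through the interior.
        column-face : ∀ b → ι b ≤ y q → y q ≢ ι b → toℕ cur ℕ.≤ b →
          (∀ {z} → z ∈ᴮ grid n → ι u ≤ x z → x z ≤ ι v → y z ≡ ι b → z ∈∂ grid n ⊎ ∃[ i ] z ∈ˢ stageSeg i) →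
          (∀ {w z} → w ≡ u ⊎ w ≡ v → Wall cur w → z ∈ᴮ grid n → x z ≡ ι w → ι b ≤ y z → ∃[ i ] z ∈ˢ stageSeg i) →
          (∀ {z} → ι u < x z → x z < ι v → ι b < y z → y z ≡ ι (Y cur) → ι l ≤ x z → x z ≤ ι h → b ≡ Y cur) →
          Face
        column-face b b≤q q≢b c≤b floor-met wall-met above = F ,
          ((≤∧≢⇒< u≤q (off-u u-stop ∘ sym) , q<v) , ≤∧≢⇒< b≤q (q≢b ∘ sym) , proj₂ (proj₂ q∈)) , record
          { inside = λ z → inside-column
          ; empty  = λ z z∈ k z∈k → empty-column z z∈ k (on k z∈k)
          ; framed = framed-column
          }
          where
          F = box (ι u) (ι v) (ι b) (ι (suc n))
          inside-column : ∀ {z} → z ∈ᴮ F → z ∈ᴮ grid n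
          inside-column ((a , b) , c , d) = (ℚₚ.≤-trans 0≤ι a , ℚₚ.≤-trans b (ι≤1+n v≤1+n)) , ℚₚ.≤-trans 0≤ι c , d
          off-u : u ≡ 0 ⊎ Wall cur u → x q ≢ ι u
          off-u (inj₁ u≡0)  e = off-left u≡0 e
          off-u (inj₂ wall) e = let (i , q∈i) = wall-met (inj₁ refl) wall q∈ᴮ e b≤q in q∉ i q∈i
          empty-column : ∀ z → z ∈ᴮ° F → ∀ k → ¬ On z k
          empty-column z (_ , b<z , _) k (full k<c e) =
            <⇒≱ b<z (ℚₚ.≤-trans (ℚₚ.≤-reflexive e) (ι-mono-≤ (ℕₚ.≤-trans k<c c≤b)))
          empty-column z ((u<z , z<v) , b<z , _) k (current _ e p p′) =
            ℚₚ.<-irrefl (trans (cong ι (above u<z z<v b<z e p p′)) (sym e)) b<z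
          empty-column z ((u<z , z<v) , _) k (upright c<k e _ _) =
            ℕₚ.<⇒≱ (ι-cancel-< (subst (_< ι v) e z<v)) (no-wall (X k) (k , c<k , refl) (ι-cancel-< (subst (ι u <_) e u<z)))
          framed-column : ∀ z → z ∈∂ F → z ∈∂ grid n ⊎ ∃[ i ] z ∈ˢ stageSeg i
          framed-column z z∈∂@(z∈F@((p , p′) , b≤z , _) , _) = by-side (∂-sides z∈∂) u-stop v-stop
            where
            z∈ = inside-column z∈F
            by-side : x z ≡ ι u ⊎ x z ≡ ι v ⊎ y z ≡ ι b ⊎ y z ≡ ι (suc n) →
              u ≡ 0 ⊎ Wall cur u → v ≡ suc n ⊎ Wall cur v → z ∈∂ grid n ⊎ ∃[ i ] z ∈ˢ stageSeg i
            by-side (inj₁ e) (inj₁ u≡0)  _        = inj₁ (sides-∂ z∈ (inj₁ (trans e (cong ι u≡0))))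
            by-side (inj₁ e) (inj₂ wall) _        = inj₂ (wall-met (inj₁ refl) wall z∈ e b≤z)
            by-side (inj₂ (inj₁ e)) _ (inj₁ v≡)   = inj₁ (sides-∂ z∈ (inj₂ (inj₁ (trans e (cong ι v≡)))))
            by-side (inj₂ (inj₁ e)) _ (inj₂ wall) = inj₂ (wall-met (inj₂ refl) wall z∈ e b≤z)
            by-side (inj₂ (inj₂ (inj₁ e))) _ _    = floor-met z∈ p p′ e
            by-side (inj₂ (inj₂ (inj₂ e))) _ _    = inj₁ (sides-∂ z∈ (inj₂ (inj₂ (inj₂ e))))

        over-current : l ℕ.≤ u → v ℕ.≤ h → ι (Y cur) ≤ y q → Face
        over-current l≤u v≤h c≤q = column-face (Y cur) c≤q
          (λ e → q∉ cur (on-current e (ℚₚ.≤-trans (ι-mono-≤ l≤u) u≤q) (ℚₚ.≤-trans (ℚₚ.<⇒≤ q<v) (ι-mono-≤ v≤h))))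
          (ℕₚ.n≤1+n _)
          (λ _ p p′ e → inj₂ (cur , on-current e (ℚₚ.≤-trans (ι-mono-≤ l≤u) p) (ℚₚ.≤-trans p′ (ι-mono-≤ v≤h))))
          (λ { _ (j , c<j , refl) z∈ e p → j , on-wall c<j z∈ e p })
          (λ _ _ _ _ _ _ → refl)

        beside-current : v ℕ.≤ l ⊎ h ℕ.≤ u → ι (toℕ cur) ≤ y q → Face
        beside-current beside c≤q = column-face (toℕ cur) c≤q (off-row ℕₚ.≤-refl) ℕₚ.≤-refl
          (λ z∈ _ _ e → below-full ℕₚ.≤-refl z∈ e)
          (λ { w≡ (j , c<j , refl) z∈ e p → j , on-outer c<j (not-inner beside w≡) z∈ e p })
          (λ u<z z<v _ _ l≤z z≤h → contradiction (l≤z , z≤h) (apart beside u<z z<v))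
          where
          u<v : u ℕ.< v
          u<v = ι-cancel-< (ℚₚ.≤-<-trans u≤q q<v)
          not-inner : v ℕ.≤ l ⊎ h ℕ.≤ u → ∀ {w} → w ≡ u ⊎ w ≡ v → ¬ (l ℕ.< w × w ℕ.< h)
          not-inner (inj₁ v≤l) (inj₁ refl) (l<w , _) = ℕₚ.<⇒≱ (ℕₚ.<-trans l<w u<v) v≤l
          not-inner (inj₁ v≤l) (inj₂ refl) (l<w , _) = ℕₚ.<⇒≱ l<w v≤l
          not-inner (inj₂ h≤u) (inj₁ refl) (_ , w<h) = ℕₚ.<⇒≱ w<h h≤u
          not-inner (inj₂ h≤u) (inj₂ refl) (_ , w<h) = ℕₚ.<⇒≱ (ℕₚ.<-trans u<v w<h) h≤u
          apart : v ℕ.≤ l ⊎ h ℕ.≤ u → ∀ {z} → ι u < z → z < ι v → ¬ (ι l ≤ z × z ≤ ι h)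
          apart (inj₁ v≤l) _ z<v (l≤z , _) = <⇒≱ z<v (ℚₚ.≤-trans (ι-mono-≤ v≤l) l≤z)
          apart (inj₂ h≤u) u<z _ (_ , z≤h) = <⇒≱ u<z (ℚₚ.≤-trans z≤h (ι-mono-≤ h≤u))

      face : Face
      face with ι-floor (suc n) (ℚₚ.<⇒≤ (proj₁ (proj₂ q∈))) (proj₂ (proj₂ q∈))
              | ι-floor (suc n) (ℚₚ.<⇒≤ (proj₁ (proj₁ q∈))) (proj₂ (proj₁ q∈))
      ... | m , _ , m≤q , q<m | p , p<1+n , p≤q , q<p with m ℕ.<? toℕ cur
      ...   | yes m<c = strip m m<c m≤q q<m
      ...   | no m≮c with next-stop cur p p<1+n | previous-stop cur p
      ...     | v , p<v , v-stop , least | u , u≤p , u-stop , most = choose (l ℕ.≤? p) (p ℕ.<? h) (ι (Y cur) ℚₚ.≤? y q)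
        where
        c≤q : ι (toℕ cur) ≤ y q
        c≤q = ℚₚ.≤-trans (ι-mono-≤ (ℕₚ.≮⇒≥ m≮c)) m≤q
        no-wall : ∀ w → Wall cur w → u ℕ.< w → v ℕ.≤ w
        no-wall w wall u<w with w ℕ.≤? p
        ... | yes w≤p = contradiction (most w wall w≤p) (ℕₚ.<⇒≱ u<w)
        ... | no w≰p  = least w wall (ℕₚ.≰⇒> w≰p)
        open Column u-stop v-stop (ℚₚ.≤-trans (ι-mono-≤ u≤p) p≤q) (ℚₚ.<-≤-trans q<p (ι-mono-≤ p<v)) no-wall
        -- Each of `l` and `h` is a wall or a side of the square, so neither falls strictly between
        -- the neighbouring stops `u` and `v`: the column is entirely over the current segment or
        -- entirely beside it.
        l-below : l ℕ.≤ p → l ≡ 0 ⊎ Wall cur l → l ℕ.≤ u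
        l-below _   (inj₁ l≡0)  = subst (ℕ._≤ u) (sym l≡0) ℕ.z≤n
        l-below l≤p (inj₂ wall) = most l wall l≤p
        h-above : p ℕ.< h → h ≡ suc n ⊎ Wall cur h → v ℕ.≤ h
        h-above _   (inj₁ h≡)   = subst (v ℕ.≤_) (sym h≡) v≤1+n
        h-above p<h (inj₂ wall) = least h wall p<h
        l-above : p ℕ.< l → l ≡ 0 ⊎ Wall cur l → v ℕ.≤ l
        l-above p<l (inj₁ l≡0)  = contradiction (subst (p ℕ.<_) l≡0 p<l) λ ()
        l-above p<l (inj₂ wall) = least l wall p<l
        h-below : h ℕ.≤ p → h ≡ suc n ⊎ Wall cur h → h ℕ.≤ u
        h-below h≤p (inj₁ h≡)   = contradiction (subst (ℕ._≤ p) h≡ h≤p) (ℕₚ.<⇒≱ p<1+n)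
        h-below h≤p (inj₂ wall) = most h wall h≤p
        choose : Dec (l ℕ.≤ p) → Dec (p ℕ.< h) → Dec (ι (Y cur) ≤ y q) → Face
        choose (no l≰p)  _         _        = beside-current (inj₁ (l-above (ℕₚ.≰⇒> l≰p) l-stop)) c≤q
        choose (yes _)   (no p≮h)  _        = beside-current (inj₂ (h-below (ℕₚ.≮⇒≥ p≮h) h-stop)) c≤q
        choose (yes l≤p) (yes p<h) (yes Y≤) = over-current (l-below l≤p l-stop) (h-above p<h h-stop) Y≤
        choose (yes l≤p) (yes p<h) (no Y≰)  = pocket (ℚₚ.≤-trans (ι-mono-≤ l≤p) p≤q)
          (ℚₚ.<-≤-trans q<p (ι-mono-≤ p<h)) c≤q (ℚₚ.≰⇒> Y≰)

    stage : Rectangulation points (grid n)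
    stage = record
      { seg         = stageSeg
      ; within      = stage-within
      ; through     = stage-through
      ; only        = stage-only
      ; noncrossing = stage-noncrossing
      ; anchored    = stage-anchored
      ; faces       = FaceAt.face
      }

  -- Operations leading from stage to stage.

  open Stage

  row-point : Fin n → ℕ → Point
  row-point j m = pt (ι m) (ι (Y j))

  NoWall : Stage → Fin n → ℕ → ℕ → Set
  NoWall S j a b = ∀ k → toℕ (cur S) ℕ.< toℕ k → k ≢ j → a ℕ.< X k → ¬ (X k ℕ.< b)

  clear-row : ∀ S j {a b} → NoWall S j a b → b ℕ.≤ suc n → ∀ q → y q ≡ ι (Y j) → ι a < x q → x q < ι b →
    q ∈ᴮ° grid n × (∀ k → k ≢ j → ¬ (q ∈ˢ stageSeg S k))
  clear-row S j {a} {b} none b≤1+n (pt u _) refl a<u u<b =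
      ( (ℚₚ.≤-<-trans (ι-mono-≤ ℕ.z≤n) a<u , ℚₚ.<-≤-trans u<b (ι-mono-≤ b≤1+n))
      , ι-mono-< (ℕ.s≤s ℕ.z≤n) , ι-mono-< (Y<1+n j))
    , λ k k≢j q∈ → missed k k≢j (on S k q∈)
    where
    missed : ∀ k → k ≢ j → ¬ On S (pt u (ι (Y j))) k
    missed k k≢j (full _ e)         = k≢j (Y-injective (sym e))
    missed k k≢j (current refl e _ _) = k≢j (Y-injective (sym e))
    missed k k≢j (upright c<k e _ _)  = none k c<k k≢j
      (ι-cancel-< (subst (ι a <_) e a<u)) (ι-cancel-< (subst (_< ι b) e u<b))

  -- The row `j` is the current one when a rotation extends it, and the next one when a flip creates
  -- its segment; in both cases the walls above `j` already cross that row.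
  stop-met : ∀ S j m → toℕ (cur S) ℕ.≤ toℕ j → m ≡ 0 ⊎ m ≡ suc n ⊎ Wall j m →
    row-point j m ∈∂ grid n ⊎ ∃[ k ] (k ≢ j × row-point j m ∈ˢ stageSeg S k)
  stop-met S j m c≤j (inj₁ refl) = inj₁ (sides-∂ ((ℚₚ.≤-refl , 0≤ι S) , Y-within S j) (inj₁ refl))
  stop-met S j m c≤j (inj₂ (inj₁ refl)) = inj₁ (sides-∂ ((0≤ι S , ℚₚ.≤-refl) , Y-within S j) (inj₂ (inj₁ refl)))
  stop-met S j m c≤j (inj₂ (inj₂ (k , j<k , refl))) = inj₂ (k , (λ { refl → ℕₚ.<-irrefl refl j<k })
    , on-wall S (ℕₚ.≤-<-trans c≤j j<k) (X-within S k , Y-within S j) refl (ι-mono-≤ (ℕ.s≤s c≤j)))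

  between-points : ∀ {v w} → Btw v w v → w ≡ v
  between-points (inj₁ (p , q)) = ℚₚ.≤-antisym q p
  between-points (inj₂ (p , q)) = ℚₚ.≤-antisym q p

  off-end : ∀ {q a} → y q ≡ y a → q ≢ a → x q ≢ x a
  off-end refl q≢a refl = q≢a refl

  extends-right : ∀ S j {a b} → toℕ (cur S) ℕ.≤ toℕ j → NoWall S j a b → a ℕ.< b → b ≡ suc n ⊎ Wall j b →
    ExtendsUntil (stage S) j (row-point j a) (row-point j b)
  extends-right S j {a} {b} c≤j none a<b b-stop = record
    { clear = λ q (qx , qy) q≢a q≢b →
        let yq = between-points qy
            (a≤q , q≤b) = Btw-between (ι-mono-≤ (ℕₚ.<⇒≤ a<b)) qx
        in clear-row S j none b≤1+n q yq (≤∧≢⇒< a≤q (off-end yq q≢a ∘ sym)) (≤∧≢⇒< q≤b (off-end yq q≢b))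
    ; stop = stop-met S j b c≤j (inj₂ b-stop)
    }
    where
    b≤1+n : b ℕ.≤ suc n
    b≤1+n = [ ℕₚ.≤-reflexive , (λ (k , _ , Xk≡b) → ℕₚ.<⇒≤ (subst (ℕ._< suc n) Xk≡b (X<1+n k))) ]′ b-stop

  extends-left : ∀ S j {a b} → toℕ (cur S) ℕ.≤ toℕ j → NoWall S j b a → b ℕ.< a → a ℕ.≤ suc n → b ≡ 0 ⊎ Wall j b →
    ExtendsUntil (stage S) j (row-point j a) (row-point j b)
  extends-left S j {a} {b} c≤j none b<a a≤1+n b-stop = record
    { clear = λ q (qx , qy) q≢a q≢b →
        let yq = between-points qy
            (b≤q , q≤a) = Btw-between (ι-mono-≤ (ℕₚ.<⇒≤ b<a)) (Btw-swap qx)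
        in clear-row S j none a≤1+n q yq (≤∧≢⇒< b≤q (off-end yq q≢b ∘ sym)) (≤∧≢⇒< q≤a (off-end yq q≢a))
    ; stop = stop-met S j b c≤j ([ inj₁ , inj₂ ∘ inj₂ ]′ b-stop)
    }

  0≢ιX : ∀ {k} → ι 0 ≢ ι (X k)
  0≢ιX e = ℚₚ.<-irrefl e (ι-mono-< (ℕ.s≤s ℕ.z≤n))

  1+n≢ιX : ∀ {k} → ι (suc n) ≢ ι (X k)
  1+n≢ιX {k} e = ℚₚ.<-irrefl (sym e) (ι-mono-< (X<1+n k))

  -- Full rows end on the frame and vertical segments end on their own abscissas, which leaves the
  -- current segment as the only one that could end on another wall. This provides the `free`
  -- conditions of both operations.
  endpoint-column : ∀ S {k i} e → k ≢ i → k ≢ cur S → x (endpoint (stageSeg S k) e) ≢ ι (X i)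
  endpoint-column S {k} e k≢i k≢c eq with stageSeg S k | view S k
  endpoint-column S lower _   _   eq | _ | full _      = 0≢ιX eq
  endpoint-column S upper _   _   eq | _ | full _      = 1+n≢ιX eq
  endpoint-column S _     _   k≢c _  | _ | current k≡c = k≢c k≡c
  endpoint-column S lower k≢i _   eq | _ | inner _ _   = k≢i (X-injective eq)
  endpoint-column S upper k≢i _   eq | _ | inner _ _   = k≢i (X-injective eq)
  endpoint-column S lower k≢i _   eq | _ | outer _ _   = k≢i (X-injective eq)
  endpoint-column S upper k≢i _   eq | _ | outer _ _   = k≢i (X-injective eq)

  -- The current segment breaks through the wall `i` at its end. In the terms of `Rotate` the wall
  -- is s₁ with `a` as its lower end, and the current segment is s₂. The wall loses its part below
  -- the current row and so turns from outer to inner; the two implications say that every other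
  -- wall keeps its kind.
  rotation : ∀ S {l′ h′} (l′<X : l′ ℕ.< X (cur S)) (X<h′ : X (cur S) ℕ.< h′)
    (l′-stop : l′ ≡ 0 ⊎ Wall (cur S) l′) (h′-stop : h′ ≡ suc n ⊎ Wall (cur S) h′) i γ →
    let S′ = record { cur = cur S ; l = l′ ; h = h′ ; l<X = l′<X ; X<h = X<h′ ; l-stop = l′-stop ; h-stop = h′-stop }
        s  = segment horizontal (ι (Y (cur S))) (ι (l S)) (ι (h S))
        s′ = segment horizontal (ι (Y (cur S))) (ι l′) (ι h′) in
    toℕ (cur S) ℕ.< toℕ i → ¬ (l S ℕ.< X i × X i ℕ.< h S) → l′ ℕ.< X i × X i ℕ.< h′ →
    (∀ k → k ≢ i → toℕ (cur S) ℕ.< toℕ k → l S ℕ.< X k × X k ℕ.< h S → l′ ℕ.< X k × X k ℕ.< h′) →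
    (∀ k → k ≢ i → toℕ (cur S) ℕ.< toℕ k → l′ ℕ.< X k × X k ℕ.< h′ → l S ℕ.< X k × X k ℕ.< h S) →
    endpoint s γ ≡ row-point (cur S) (X i) → endpoint s′ (other γ) ≡ endpoint s (other γ) →
    ExtendsUntil (stage S) (cur S) (row-point (cur S) (X i)) (endpoint s′ γ) →
    Adjacent (stage S) (stage S′)
  rotation S {l′} {h′} l′<X X<h′ l′-stop h′-stop i γ c<i ¬inner inner′ wider narrower foot fixed extent =
    rotate i (cur S) lower γ (record
      { distinct  = λ { refl → ℕₚ.<-irrefl refl c<i }
      ; c∈ap      = subst₂ (λ c s → c ∈[ endpoint s lower , points i ]) (sym c≡) (sym (seg-is S (outer c<i ¬inner)))
                      (inj₁ (ℚₚ.≤-refl , ℚₚ.≤-refl) , inj₁ (ι-mono-≤ (ℕₚ.n≤1+n _) , ι-mono-≤ (ℕ.s≤s (ℕₚ.<⇒≤ c<i))))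
      ; free      = λ k e k≢i k≢c (p , _) → endpoint-column S e k≢i k≢c (between-points
                      (subst₂ (λ c s → Btw (x (endpoint s lower)) (x (endpoint (stageSeg S k) e)) (x c))
                        c≡ (seg-is S (outer c<i ¬inner)) p))
      ; s₁-orient = trans (cong orient seg-i′) (sym (cong orient (seg-is S (outer c<i ¬inner))))
      ; s₁-moved  = trans (cong (λ s → endpoint s lower) seg-i′) (sym c≡)
      ; s₁-fixed  = trans (cong (λ s → endpoint s upper) seg-i′) (sym (cong (λ s → endpoint s upper) (seg-is S (outer c<i ¬inner))))
      ; s₂-orient = trans (cong orient seg-c′) (sym (cong orient seg-c))
      ; s₂-fixed  = trans (cong (λ s → endpoint s (other γ)) seg-c′)
                      (trans fixed (sym (cong (λ s → endpoint s (other γ)) seg-c)))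
      ; s₂-beyond = subst₂ _∈ˢ°_ (sym c≡) (sym seg-c′) (refl , ι-mono-< (proj₁ inner′) , ι-mono-< (proj₂ inner′))
      ; s₂-extent = subst₂ (ExtendsUntil (stage S) (cur S)) (sym c≡) (sym (cong (λ s → endpoint s γ) seg-c′)) extent
      ; rest      = λ k k≢i k≢c → same k k≢i k≢c (view S k)
      })
    where
    S′ = record { cur = cur S ; l = l′ ; h = h′ ; l<X = l′<X ; X<h = X<h′ ; l-stop = l′-stop ; h-stop = h′-stop }
    seg-c = seg-is S (current refl)
    seg-c′ = seg-is S′ (current refl)
    seg-i′ = seg-is S′ (inner c<i inner′)
    c≡ = trans (cong (λ s → endpoint s γ) seg-c) foot
    same : ∀ k → k ≢ i → k ≢ cur S → ∀ {s} → View S k s → stageSeg S′ k ≡ s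
    same k _   _   (full k<c)      = seg-is S′ (full k<c)
    same k _   k≢c (current k≡c)   = contradiction k≡c k≢c
    same k k≢i _   (inner c<k p)   = seg-is S′ (inner c<k (wider k k≢i c<k p))
    same k k≢i _   (outer c<k ¬p)  = seg-is S′ (outer c<k (¬p ∘ narrower k k≢i c<k))

  Reaches : Rectangulation points (grid n) → Stage → Set
  Reaches t S = ∃ (Walk (stage S) t)

  -- The rest of the walk is handed over as `finish`, since only the row and the right end of the
  -- resulting stage are known beforehand. The number `d` bounds the grid lines still to be passed,
  -- and each rotation passes at least one.
  spread-right : ∀ {t} S → (∀ S′ → cur S′ ≡ cur S → h S′ ≡ suc n → Reaches t S′) →
    ∀ d → suc n ℕ.≤ h S ℕ.+ d → Reaches t S
  spread-right S finish d bound with h-stop S in stop-eq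
  ... | inj₁ h≡1+n = finish S refl h≡1+n
  spread-right S finish zero bound | inj₂ (i , _ , Xi≡h) =
    contradiction (subst (suc n ℕ.≤_) (trans (ℕₚ.+-identityʳ (h S)) (sym Xi≡h)) bound) (ℕₚ.<⇒≱ (X<1+n i))
  spread-right {t} S finish (suc d) bound | inj₂ (i , c<i , Xi≡h)
    with next-stop (cur S) (h S) (subst (ℕ._< suc n) Xi≡h (X<1+n i))
  ... | v , h<v , v-stop , least =
    let (m , walk) = spread-right S′ (finish) d
                       (ℕₚ.≤-trans bound (ℕₚ.≤-trans (ℕₚ.≤-reflexive (ℕₚ.+-suc (h S) d)) (ℕₚ.+-monoˡ-≤ d h<v)))
    in suc m , step (rotation S (l<X S) X<v (l-stop S) v-stop i upper c<i
         (λ (_ , Xi<h) → ℕₚ.<-irrefl Xi≡h Xi<h)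
         (subst (l S ℕ.<_) (sym Xi≡h) (ℕₚ.<-trans (l<X S) (X<h S)) , subst (ℕ._< v) (sym Xi≡h) h<v)
         (λ _ _ _ (p , q) → p , ℕₚ.<-trans q h<v)
         (λ k k≢i c<k (p , q) → p , inside k k≢i c<k q)
         (cong (row-point (cur S)) (sym Xi≡h)) refl
         (extends-right S (cur S) ℕₚ.≤-refl
           (λ k c<k _ a<k k<v → ℕₚ.<⇒≱ k<v (least (X k) (k , c<k , refl) (subst (ℕ._< X k) Xi≡h a<k)))
           (subst (ℕ._< v) (sym Xi≡h) h<v) v-stop)) walk
    where
    X<v = ℕₚ.<-trans (X<h S) h<v
    S′ = record { cur = cur S ; l = l S ; h = v ; l<X = l<X S ; X<h = X<v ; l-stop = l-stop S ; h-stop = v-stop }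
    inside : ∀ k → k ≢ i → toℕ (cur S) ℕ.< toℕ k → X k ℕ.< v → X k ℕ.< h S
    inside k k≢i c<k k<v with ℕₚ.<-cmp (X k) (h S)
    ... | tri< k<h _ _ = k<h
    ... | tri≈ _ k≡h _ = contradiction (column-injective (ℕₚ.suc-injective (trans k≡h (sym Xi≡h)))) k≢i
    ... | tri> _ _ h<k = contradiction (least (X k) (k , c<k , refl) h<k) (ℕₚ.<⇒≱ k<v)

  spread-left : ∀ {t} S → (∀ S′ → cur S′ ≡ cur S → l S′ ≡ 0 → h S′ ≡ h S → Reaches t S′) →
    ∀ d → l S ℕ.≤ d → Reaches t S
  spread-left S finish d bound with l-stop S
  ... | inj₁ l≡0 = finish S refl l≡0 refl
  spread-left S finish zero bound | inj₂ (i , _ , Xi≡l) = contradiction (subst (ℕ._≤ 0) (sym Xi≡l) bound) λ ()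
  spread-left {t} S finish (suc d) bound | inj₂ (i , c<i , Xi≡l)
    with previous-stop (cur S) (column i)
  ... | v , v≤ , v-stop , most =
    let (m , walk) = spread-left S′ (finish) d (ℕₚ.≤-pred (ℕₚ.<-≤-trans v<l bound))
    in suc m , step (rotation S v<X (X<h S) v-stop (h-stop S) i lower c<i
         (λ (l<Xi , _) → ℕₚ.<-irrefl (sym Xi≡l) l<Xi)
         (ℕ.s≤s v≤ , subst (ℕ._< h S) (sym Xi≡l) (ℕₚ.<-trans (l<X S) (X<h S)))
         (λ _ _ _ (p , q) → ℕₚ.<-trans v<l p , q)
         (λ k k≢i c<k (p , q) → inside k k≢i c<k p , q)
         (cong (row-point (cur S)) (sym Xi≡l)) refl
         (extends-left S (cur S) ℕₚ.≤-refl
           (λ k c<k _ v<k k<i → ℕₚ.<⇒≱ v<k (most (X k) (k , c<k , refl) (ℕₚ.≤-pred k<i)))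
           (ℕ.s≤s v≤) (ℕₚ.<⇒≤ (X<1+n i)) v-stop)) walk
    where
    v<l : v ℕ.< l S
    v<l = subst (v ℕ.<_) Xi≡l (ℕ.s≤s v≤)
    v<X = ℕₚ.<-trans v<l (l<X S)
    S′ = record { cur = cur S ; l = v ; h = h S ; l<X = v<X ; X<h = X<h S ; l-stop = v-stop ; h-stop = h-stop S }
    inside : ∀ k → k ≢ i → toℕ (cur S) ℕ.< toℕ k → v ℕ.< X k → l S ℕ.< X k
    inside k k≢i c<k v<k with ℕₚ.<-cmp (l S) (X k)
    ... | tri< l<k _ _ = l<k
    ... | tri≈ _ l≡k _ = contradiction (column-injective (ℕₚ.suc-injective (trans (sym l≡k) (sym Xi≡l)))) k≢i
    ... | tri> _ _ k<l = contradiction (most (X k) (k , c<k , refl) (ℕₚ.≤-pred (subst (X k ℕ.<_) (sym Xi≡l) k<l))) (ℕₚ.<⇒≱ v<k)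

  module Next (S : Stage) (l≡0 : l S ≡ 0) (h≡1+n : h S ≡ suc n) (c : Fin n) (c≡ : toℕ c ≡ suc (toℕ (cur S))) where

    lefts = previous-stop c (column c)
    rights = next-stop c (X c) (X<1+n c)

    next : Stage
    next = record
      { cur = c ; l = proj₁ lefts ; h = proj₁ rights
      ; l<X = ℕ.s≤s (proj₁ (proj₂ lefts)) ; X<h = proj₁ (proj₂ rights)
      ; l-stop = proj₁ (proj₂ (proj₂ lefts)) ; h-stop = proj₁ (proj₂ (proj₂ rights)) }

    cur<c : toℕ (cur S) ℕ.< toℕ c
    cur<c = ℕₚ.≤-reflexive (sym c≡)

    cur<⇒c≤ : ∀ {k : Fin n} → toℕ (cur S) ℕ.< toℕ k → toℕ c ℕ.≤ toℕ k
    cur<⇒c≤ = subst (ℕ._≤ _) (sym c≡)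

    within-current : ∀ k → l S ℕ.< X k × X k ℕ.< h S
    within-current k = subst (ℕ._< X k) (sym l≡0) (ℕ.s≤s ℕ.z≤n) , subst (X k ℕ.<_) (sym h≡1+n) (X<1+n k)

    above-c : ∀ {k} → toℕ (cur S) ℕ.< toℕ k → k ≢ c → toℕ c ℕ.< toℕ k
    above-c cur<k k≢c = ℕₚ.≤∧≢⇒< (cur<⇒c≤ cur<k) (λ e → k≢c (sym (Finₚ.toℕ-injective e)))

    none-right : NoWall S c (X c) (h next)
    none-right k cur<k k≢c c<k k<h = ℕₚ.<⇒≱ k<h (proj₂ (proj₂ (proj₂ rights)) (X k) (k , above-c cur<k k≢c , refl) c<k)

    none-left : NoWall S c (l next) (X c)
    none-left k cur<k k≢c l<k k<c = ℕₚ.<⇒≱ l<k (proj₂ (proj₂ (proj₂ lefts)) (X k) (k , above-c cur<k k≢c , refl) (ℕₚ.≤-pred k<c))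

    seg-c = seg-is S (inner cur<c (within-current c))
    seg-c′ = seg-is next (current refl)

    -- The current segment of `S` spans the square, so all walls rest on it and no segment ends on
    -- the wall `c`. The flipped segment stops at the nearest walls of the points above it.
    flip-next : Adjacent (stage S) (stage next)
    flip-next = flip c (record
      { free   = λ k e k≢c ep∈ → not-on-c k e k≢c (proj₁ (subst (endpoint (stageSeg S k) e ∈ˢ_) seg-c ep∈))
      ; turned = λ same → contradiction (trans (sym (cong orient seg-c′)) (trans same (cong orient seg-c))) λ ()
      ; extent = λ e → subst (ExtendsUntil (stage S) c (points c)) (sym (cong (λ s → endpoint s e) seg-c′)) (extends e)
      ; rest   = λ k k≢c → same k k≢c (view S k)
      })
      where
      not-on-c : ∀ k e → k ≢ c → x (endpoint (stageSeg S k) e) ≢ ι (X c)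
      not-on-c k e k≢c with k Finₚ.≟ cur S
      not-on-c k e     k≢c | no k≢cur = endpoint-column S e k≢c k≢cur
      not-on-c k lower k≢c | yes refl rewrite seg-is S (current refl) | l≡0   = 0≢ιX
      not-on-c k upper k≢c | yes refl rewrite seg-is S (current refl) | h≡1+n = 1+n≢ιX
      extends : ∀ e → ExtendsUntil (stage S) c (points c) (endpoint (segment horizontal (ι (Y c)) (ι (l next)) (ι (h next))) e)
      extends lower = extends-left S c (ℕₚ.<⇒≤ cur<c) none-left (l<X next) (ℕₚ.<⇒≤ (X<1+n c)) (l-stop next)
      extends upper = extends-right S c (ℕₚ.<⇒≤ cur<c) none-right (X<h next) (h-stop next)
      same : ∀ k → k ≢ c → ∀ {s} → View S k s → stageSeg next k ≡ s
      same k _   (full k<cur)   = seg-is next (full (ℕₚ.<-trans k<cur cur<c))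
      same k _   (current refl) = trans (seg-is next (full cur<c))
        (cong₂ (λ a b → segment horizontal (ι (Y k)) (ι a) (ι b)) (sym l≡0) (sym h≡1+n))
      -- The remaining walls change from inner to outer without moving: none is strictly between the
      -- ends of the new segment, and `toℕ c` equals `Y (cur S)`, the line on which they stand.
      same k k≢c (inner cur<k _) = trans
        (seg-is next (outer (above-c cur<k k≢c) λ (p , q) → between k cur<k k≢c p q)) (cong (wallˢ k) c≡)
        where
        between : ∀ k → toℕ (cur S) ℕ.< toℕ k → k ≢ c → l next ℕ.< X k → ¬ (X k ℕ.< h next)
        between k cur<k k≢c p q with ℕₚ.<-cmp (X k) (X c)
        ... | tri< k<c _ _ = none-left k cur<k k≢c p k<c
        ... | tri≈ _ k≡c _ = k≢c (column-injective (ℕₚ.suc-injective k≡c))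
        ... | tri> _ _ c<k = none-right k cur<k k≢c c<k q
      same k _   (outer _ ¬p)   = contradiction (within-current k) ¬p

  spanning : Fin n → Stage
  spanning c = record
    { cur = c ; l = 0 ; h = suc n ; l<X = ℕ.s≤s ℕ.z≤n ; X<h = X<1+n c ; l-stop = inj₁ refl ; h-stop = inj₁ refl }

  sweep : ∀ last d S → l S ≡ 0 → h S ≡ suc n → toℕ last ≡ toℕ (cur S) ℕ.+ d →
    Reaches (stage (spanning last)) S
  sweep last zero S@(record { cur = c }) refl refl eq
    with Finₚ.toℕ-injective (trans eq (ℕₚ.+-identityʳ (toℕ c)))
  -- The stages may still differ in the evidence stored for their stops, so they are compared
  -- segment by segment.
  ... | refl = 0 , stay λ k → sym (same k (view S k))
    where
    same : ∀ k {s} → View S k s → stageSeg (spanning c) k ≡ s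
    same k (full k<c)     = seg-is (spanning c) (full k<c)
    same k (current k≡c)  = seg-is (spanning c) (current k≡c)
    same k (inner c<k p)  = seg-is (spanning c) (inner c<k p)
    same k (outer c<k ¬p) = seg-is (spanning c) (outer c<k ¬p)
  sweep last (suc d) S l≡0 h≡1+n eq =
    let (m , walk) = spread-right next (λ S′ cur≡ h≡ →
                       spread-left S′ (λ S″ cur≡′ l≡ h≡′ →
                         sweep last d S″ l≡ (trans h≡′ h≡) (trans left-over
                           (cong (ℕ._+ d) (sym (trans (cong toℕ (trans cur≡′ cur≡)) c≡)))))
                         (l S′) ℕₚ.≤-refl)
                       (suc n) (ℕₚ.m≤n+m (suc n) _)
    in suc m , step flip-next walk
    where
    left-over : toℕ last ≡ suc (toℕ (cur S)) ℕ.+ d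
    left-over = trans eq (ℕₚ.+-suc _ d)
    c<n : suc (toℕ (cur S)) ℕ.< n
    c<n = ℕₚ.≤-<-trans (subst (suc (toℕ (cur S)) ℕ.≤_) (sym left-over) (ℕₚ.m≤m+n _ d)) (Finₚ.toℕ<n last)
    c≡ : toℕ (fromℕ< c<n) ≡ suc (toℕ (cur S))
    c≡ = Finₚ.toℕ-fromℕ< c<n
    open Next S l≡0 h≡1+n (fromℕ< c<n) c≡

-- The two extreme rectangulations and their distance.

module Endpoints (k n : ℕ) (2^k≤1+n : 2 ℕ.^ k ℕ.≤ suc n) where

  open BitReversal k (suc n) 2^k≤1+n
  open Crossing {P = points} {R = grid (suc n)} noncorectilinear points-inside
  open Sweep (suc n) (column ∘ toℕ) (column-< ∘ Finₚ.toℕ<n) (Finₚ.toℕ-injective ∘ column-injective)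
    hiding (points)
  open Stage
  open Tile

  start finish : Stage
  start  = spanning Fin.zero
  finish = spanning (Fin.fromℕ n)

  only-lowest-horizontal : ∀ k → orient (stageSeg start k) ≡ horizontal → level (stageSeg start k) ≡ ι 1
  only-lowest-horizontal k hor with stageSeg start k | view start k
  only-lowest-horizontal k _  | _ | current _ = refl
  only-lowest-horizontal k () | _ | inner _ _
  only-lowest-horizontal k () | _ | outer _ _

  -- Both halves would have to be crossed at the single level `ι 1`, but they share no height.
  start-unconverted : ∀ d → ¬ Converted (stage start) d
  start-unconverted d conv with conv lower | conv upper
  ... | i , horᵢ , _ , b<i , i<t | j , horⱼ , _ , b<j , j<t = rows-disjoint d lower
    (b<i , i<t)
    (subst (λ l → κ _ < l × l < κ _)
      (trans (only-lowest-horizontal j horⱼ) (sym (only-lowest-horizontal i horᵢ))) (b<j , j<t))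

  finish-crossed : ∀ {T} → Tile T → Crossed (stage finish) T
  finish-crossed {T} tile = z , through-z
    where
    z = resident tile
    through-z : orient (stageSeg finish z) ≡ horizontal
              × (lo (stageSeg finish z) ≤ left T × right T ≤ hi (stageSeg finish z))
              × (bottom T < level (stageSeg finish z) × level (stageSeg finish z) < top T)
    through-z with stageSeg finish z | view finish z
    ... | _ | full _ = refl , (ℚₚ.<⇒≤ (left-inside tile) , ℚₚ.<⇒≤ (right-inside tile)) , proj₂ (resides tile)
    ... | _ | current z≡ = refl , (ℚₚ.<⇒≤ (left-inside tile) , ℚₚ.<⇒≤ (right-inside tile))
                         , subst (λ i → bottom T < ι (suc (toℕ i)) × ι (suc (toℕ i)) < top T) z≡ (proj₂ (resides tile))
    ... | _ | inner last<z _ = contradiction (Finₚ.≤fromℕ z) (ℕₚ.<⇒≱ last<z)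
    ... | _ | outer last<z _ = contradiction (Finₚ.≤fromℕ z) (ℕₚ.<⇒≱ last<z)

  connected : ∃ (Walk (stage start) (stage finish))
  connected = sweep (Fin.fromℕ n) n start refl refl (Finₚ.toℕ-fromℕ n)

  distance : ∀ m → Walk (stage start) (stage finish) m → k ℕ.* 2 ℕ.^ (k ℕ.∸ 1) ℕ.≤ m
  distance m walk = subst (k ℕ.* 2 ℕ.^ (k ℕ.∸ 1) ℕ.≤_) (ℕₚ.+-identityʳ m)
    (walk-length walk [] (λ i conv → contradiction conv (start-unconverted (block i)))
      (λ d e → finish-crossed (half-tile d e)))

-- The constant and the conclusion.

binary-length : ∀ n → ∃[ k ] (2 ℕ.^ k ℕ.≤ suc n × suc n ℕ.< 2 ℕ.^ suc k)
binary-length zero = 0 , ℕₚ.≤-refl , ℕₚ.≤-refl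
binary-length (suc n) with binary-length n
... | k , 2^k≤ , <2^1+k with suc (suc n) ℕ.<? 2 ℕ.^ suc k
...   | yes < = k , ℕₚ.m≤n⇒m≤1+n 2^k≤ , <
...   | no ≮  = suc k , ℕₚ.≮⇒≥ ≮ , ℕₚ.≤-<-trans <2^1+k (ℕₚ.^-monoʳ-< 2 (ℕ.s≤s (ℕ.s≤s ℕ.z≤n)) (ℕₚ.n<1+n (suc k)))

-- For k ≥ 1 the logarithm is at most k + 1 ≤ 2 k, and 2 ^ (k + 1) times 2 k is 8 times k 2 ^ (k -
-- 1); this is the source of the constant 1/8. For k = 0 the logarithm vanishes because n ≤ 1.
n⌈log₂n⌉-bound : ∀ k n → n ℕ.< 2 ℕ.^ suc k → n ℕ.* ⌈log₂ n ⌉ ℕ.≤ 8 ℕ.* (k ℕ.* 2 ℕ.^ (k ℕ.∸ 1))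
n⌈log₂n⌉-bound zero n n<2 = ℕₚ.≤-trans
  (ℕₚ.*-monoʳ-≤ n (Logarithm.⌈log₂⌉-mono-≤ (ℕₚ.≤-pred n<2))) (ℕₚ.≤-reflexive (ℕₚ.*-zeroʳ n))
n⌈log₂n⌉-bound (suc k) n n<2^2+k = begin
  n ℕ.* ⌈log₂ n ⌉
    ≤⟨ ℕₚ.*-mono-≤ (ℕₚ.<⇒≤ n<2^2+k) (ℕₚ.≤-trans (Logarithm.⌈log₂⌉-mono-≤ (ℕₚ.<⇒≤ n<2^2+k))
                                               (ℕₚ.≤-reflexive (Logarithm.⌈log₂2^n⌉≡n (suc (suc k))))) ⟩
  2 ℕ.^ suc (suc k) ℕ.* suc (suc k)
    ≤⟨ ℕₚ.*-monoʳ-≤ (2 ℕ.^ suc (suc k)) (ℕₚ.m≤m+n (suc (suc k)) k) ⟩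
  2 ℕ.^ suc (suc k) ℕ.* (suc (suc k) ℕ.+ k)
    ≡⟨ solve 2 (λ p q → (con 2 :* (con 2 :* p)) :* (con 2 :+ q :+ q) := con 8 :* ((con 1 :+ q) :* p)) refl (2 ℕ.^ k) k ⟩
  8 ℕ.* (suc k ℕ.* 2 ℕ.^ k) ∎
  where
  open ℕₚ.≤-Reasoning
  open +-*-Solver

⅛ : ℚ
⅛ = ℤ.+ 1 / 8

⅛-scale : ∀ a b m → a ℕ.* b ℕ.≤ 8 ℕ.* m → ⅛ * (fromℕ a * fromℕ b) ≤ fromℕ m
⅛-scale a b m ab≤8m = begin
  ⅛ * (fromℕ a * fromℕ b) ≡⟨ cong (⅛ *_) (fromℕ-* a b) ⟩
  ⅛ * fromℕ (a ℕ.* b)     ≤⟨ ℚₚ.*-monoˡ-≤-nonNeg ⅛ (fromℕ-mono-≤ ab≤8m) ⟩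
  ⅛ * fromℕ (8 ℕ.* m)     ≡⟨ cong (⅛ *_) (fromℕ-* 8 m) ⟨
  ⅛ * (fromℕ 8 * fromℕ m) ≡⟨ ℚₚ.*-assoc ⅛ (fromℕ 8) (fromℕ m) ⟨
  (⅛ * fromℕ 8) * fromℕ m ≡⟨ ℚₚ.*-identityˡ (fromℕ m) ⟩
  fromℕ m                 ∎
  where open ℚₚ.≤-Reasoning

theorem2 : ∃[ c ] (0ℚ < c × (∀ (n : ℕ) → NonZero n →
    Σ (PointSet n) λ P →
    Noncorectilinear P
    × (∀ i → P i ∈ᴮ° square n)
    × DiameterAtLeast P (square n) (c * (fromℕ n * fromℕ ⌈log₂ n ⌉))))
theorem2 = ⅛ , toWitness {a? = 0ℚ ℚₚ.<? ⅛} _ , diameter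
  where
  diameter : ∀ n → NonZero n → Σ (PointSet n) λ P → Noncorectilinear P × (∀ i → P i ∈ᴮ° square n)
    × DiameterAtLeast P (square n) (⅛ * (fromℕ n * fromℕ ⌈log₂ n ⌉))
  diameter (suc n) _ with binary-length n
  ... | k , 2^k≤1+n , 1+n<2^1+k = points , noncorectilinear
    , subst (λ R → ∀ i → points i ∈ᴮ° R) (sym (square-ι (suc n))) points-inside
    , subst (λ R → DiameterAtLeast points R (⅛ * (fromℕ (suc n) * fromℕ ⌈log₂ suc n ⌉))) (sym (square-ι (suc n)))
        (stage start , stage finish , connected , λ m walk → ⅛-scale (suc n) ⌈log₂ suc n ⌉ m
          (ℕₚ.≤-trans (n⌈log₂n⌉-bound k (suc n) 1+n<2^1+k) (ℕₚ.*-monoʳ-≤ 8 (distance m walk))))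
    where
    open BitReversal k (suc n) 2^k≤1+n
    open Sweep (suc n) (column ∘ toℕ) (column-< ∘ Finₚ.toℕ<n) (Finₚ.toℕ-injective ∘ column-injective)
      using (module Stage)
    open Stage using (stage)
    open Endpoints k n 2^k≤1+n
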